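{- Let $B$ be a Ferrers board with $n$ columns, padded with columns of height zero on the left so that its root vector $\xi(B)=\langle z_1,\ldots,z_n\rangle$ has only non-negative entries. For each integer $k$ let $v_k$ be the number of entries of $\xi(B)$ equal to $k$, and let $M$ be the greatest integer with $v_M\neq 0$. Then the rook equivalence graph $G(B)$ is connected if and only if, for every $0\le i<M-1$, $v_i>1$ implies $v_{i+1}>1$.
   Context: A Ferrers board is given by a weakly increasing sequence of non-negative integers $B=(b_1,\ldots,b_n)$ of column heights; it is the set of unit cells in the first quadrant lying in column $i$ and rows $1,\ldots,b_i$. Prepending columns of height $0$ on the left does not change the board, and boards are compared using the same number of columns by such padding. A placement of $k$ rooks on $B$ is a set of $k$ cells of $B$ no two in the same row or column; $r_k(B)$ is the number of such placements. Two boards are rook equivalent if they have equal $r_k$ for all $k\ge 0$. The root vector of $B$ is $\xi(B)=\langle 0-b_1,1-b_2,\ldots,(n-1)-b_n\rangle$. The rook equivalence graph $G(B)$ has as vertices all Ferrers boards rook equivalent to $B$, and $\{B_1,B_2\}$ is an edge iff, written with the same number of columns, $B_1$ and $B_2$ differ in exactly two columns $i$ and $j$, where $B_1$ has $k$ more cells than $B_2$ in column $i$ and $k$ fewer cells than $B_2$ in column $j$, for some $k>0$. -}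

module Defs where

open import Data.Fin.Base using (Fin; toℕ)
import Data.Fin.Properties as Fin
open import Data.Integer.Base as ℤ using (ℤ; +_)
import Data.Integer.Properties as ℤ
open import Data.List.Base as List using (List; []; _∷_; _++_)
open import Data.List.Relation.Unary.AllPairs using (AllPairs; allPairs?)
open import Data.Nat.Base using (ℕ; zero; suc; _+_; _≤_; _>_)
import Data.Nat.Properties as ℕ
open import Data.Product.Base using (Σ-syntax; ∃₂; ∃-syntax; _×_; _,_)
open import Data.Sum.Base using (_⊎_)
open import Data.Vec.Base as Vec using (Vec)
open import Data.Vec.Relation.Unary.Linked using (Linked)
open import Relation.Binary.Construct.Closure.ReflexiveTransitive using (Star)
open import Relation.Binary.PropositionalEquality.Core using (_≡_; _≢_)
open import Relation.Nullary.Decidable using (Dec; ¬?; _×-dec_)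

record FerrersBoard (n : ℕ) : Set where
  field
    heights    : Vec ℕ n
    increasing : Linked _≤_ heights

  height : Fin n → ℕ
  height = Vec.lookup heights

open FerrersBoard public

-- Two presentations, possibly with different numbers of columns, of the same
-- board: they agree after prepending columns of height zero.
infix 4 _≐_
_≐_ : ∀ {m n} → FerrersBoard m → FerrersBoard n → Set
B ≐ C = ∃₂ λ p q →
  List.replicate p 0 ++ Vec.toList (heights B) ≡
  List.replicate q 0 ++ Vec.toList (heights C)

-- (column , row), with rows numbered from 1.
Cell : ℕ → Set
Cell n = Fin n × ℕ

cells : ∀ {n} → FerrersBoard n → List (Cell n)
cells {n} B =
  List.concatMap (λ i → List.map (i ,_) (List.applyUpTo suc (height B i)))
                 (List.allFin n)

-- All sublists of length k; as `cells` has no repetitions, these represent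
-- the k-element sets of cells, each exactly once.
choose : ∀ {A : Set} → ℕ → List A → List (List A)
choose zero    xs       = [] ∷ []
choose (suc k) []       = []
choose (suc k) (x ∷ xs) = List.map (x ∷_) (choose k xs) ++ choose (suc k) xs

NonAttacking : ∀ {n} → List (Cell n) → Set
NonAttacking = AllPairs λ (i , r) (j , s) → i ≢ j × r ≢ s

nonAttacking? : ∀ {n} (cs : List (Cell n)) → Dec (NonAttacking cs)
nonAttacking? = allPairs? λ (i , r) (j , s) → ¬? (i Fin.≟ j) ×-dec ¬? (r ℕ.≟ s)

placements : ∀ {n} → ℕ → FerrersBoard n → List (List (Cell n))
placements k B = List.filter nonAttacking? (choose k (cells B))

rookNumber : ∀ {n} → ℕ → FerrersBoard n → ℕ
rookNumber k B = List.length (placements k B)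

RookEquivalent : ∀ {m n} → FerrersBoard m → FerrersBoard n → Set
RookEquivalent B C = ∀ k → rookNumber k B ≡ rookNumber k C

-- Columns are indexed from 0 here, so the entry for column i is i - bᵢ.
rootVector : ∀ {n} → FerrersBoard n → Vec ℤ n
rootVector B = Vec.tabulate λ i → + toℕ i ℤ.- + height B i

multiplicity : ∀ {n} → FerrersBoard n → ℤ → ℕ
multiplicity B k = Vec.count (k ℤ.≟_) (rootVector B)

IsGreatestRoot : ∀ {n} → FerrersBoard n → ℤ → Set
IsGreatestRoot B M =
  multiplicity B M ≢ 0 × (∀ k → multiplicity B k ≢ 0 → k ℤ.≤ M)

DifferInTwoColumns : ∀ {n} → FerrersBoard n → FerrersBoard n → Set
DifferInTwoColumns B C = ∃[ i ] ∃[ j ] i ≢ j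
  × (∀ l → l ≢ i → l ≢ j → height B l ≡ height C l)
  × ∃[ k ] k > 0
  × height B i ≡ height C i + k
  × height B j + k ≡ height C j

-- Vertices of G(B), as a setoid: they are to be compared by `_≐_` on the
-- underlying boards.
record Vertex {n} (B : FerrersBoard n) : Set where
  field
    columns    : ℕ
    board      : FerrersBoard columns
    equivalent : RookEquivalent B board

open Vertex public

module _ {n} {B : FerrersBoard n} where

  SameVertex : Vertex B → Vertex B → Set
  SameVertex X Y = board X ≐ board Y

  -- Symmetric, since i and j can be exchanged in DifferInTwoColumns.
  Adjacent : Vertex B → Vertex B → Set
  Adjacent X Y = Σ[ N ∈ ℕ ] Σ[ C ∈ FerrersBoard N ] Σ[ D ∈ FerrersBoard N ]
    C ≐ board X × D ≐ board Y × DifferInTwoColumns C D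

-- A walk may also pass between two presentations of the same vertex.
Connected : ∀ {n} → FerrersBoard n → Set
Connected B = (X Y : Vertex B) → Star (λ V W → SameVertex V W ⊎ Adjacent V W) X Y

{-# OPTIONS --safe #-}

-- With z = i - b the root of a column, appending columns acts on the sequence of
-- rook numbers by operators that commute up to exchanging roots and that are
-- injective, and evaluating the sequence in the falling factorial basis gives
-- Π (x - zᵢ). Hence boards with equally many columns are rook equivalent iff their
-- roots are the same multiset. So, after padding, the vertices of G(B) are the words
-- with the letters of ξ(B) which start with 0 and never rise by more than 1, and the
-- edges exchange two letters.
--
-- If the condition holds, let t be the least repeated letter. A last letter y + 1 > t
-- can be lowered: y is repeated, so there is a first letter below y + 1 after the
-- first y, and it may be exchanged with the last one. So every word is connected to
-- one ending in t; that t is removed, and induction on the length applies.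
--
-- If i is repeated, i + 1 is not, and i + 2 occurs, the i + 1 is preceded by letters
-- ≤ i and followed by a letter ≥ i + 2. Hence no edge moves it, although both of two
-- neighbouring positions are possible for it.

module Submission where

open import Defs
open import Algebra.Properties.AbelianGroup using (∙-cancelʳ)
open import Data.Empty using (⊥)
open import Data.Fin.Base as Fin using (Fin; toℕ; fromℕ<)
import Data.Fin.Properties as Fin
open import Data.Integer.Base using (ℤ; +_; -[1+_]; 0ℤ; 1ℤ; +≤+)
  renaming (_+_ to _+ᶻ_; _-_ to _-ᶻ_; _*_ to _*ᶻ_; _≤_ to _≤ᶻ_; _<_ to _<ᶻ_)
import Data.Integer.Base as ℤ
import Data.Integer.Properties as ℤ
import Data.Integer.Tactic.RingSolver as ℤ
open import Data.List.Base
  using (List; []; _∷_; _++_; _ʳ++_; map; filter; length; replicate; reverse;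
         applyUpTo; applyDownFrom; concatMap; allFin)
open import Data.List.Membership.Propositional using (_∈_)
open import Data.List.Membership.Propositional.Properties
  using (∈-∃++; ∈-applyUpTo⁺; ∈-applyDownFrom⁺; ∈-applyDownFrom⁻)
open import Data.List.Properties
  using (filter-accept; filter-reject; filter-++; filter-≐; filter-all; filter-none;
         length-++; length-map; length-replicate; length-reverse; length-applyUpTo;
         length-applyDownFrom; ++-assoc; ++-identityʳ; map-tabulate; map-applyDownFrom;
         map-id; map-∘; reverse-++; reverse-applyUpTo)
open import Data.List.Relation.Binary.Permutation.Propositional
  using (_↭_; refl; prep; swap; trans; ↭-sym; ↭-trans; ↭-reflexive; ↭⇒↭ₛ)
open import Data.List.Relation.Binary.Permutation.Propositional.Properties
  using (↭-length; ↭-reverse; filter-↭; map⁺; shift; drop-∷; ∷↭∷ʳ; ∈-resp-↭; All-resp-↭)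
open import Data.List.Relation.Binary.Permutation.Setoid.Properties using (Unique-resp-↭)
open import Data.List.Relation.Unary.All as All using ([]; _∷_; all?)
import Data.List.Relation.Unary.All.Properties as All
open import Data.List.Relation.Unary.AllPairs as AllPairs using (AllPairs; []; _∷_)
import Data.List.Relation.Unary.AllPairs.Properties as AllPairs
open import Data.List.Relation.Unary.Any using (here; there)
open import Data.List.Relation.Unary.Linked.Properties using (Linked⇒AllPairs)
open import Data.List.Relation.Unary.Unique.Propositional using (Unique)
open import Data.List.Relation.Unary.Unique.Propositional.Properties using (applyUpTo⁺₁)
open import Data.Nat.Base as ℕ using (ℕ; zero; suc; z≤n; s≤s; _>_)
import Data.Nat.Properties as ℕ
open import Data.Product.Base using (Σ-syntax; ∃-syntax; _×_; _,_; proj₁; proj₂)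
open import Data.Sum.Base using (_⊎_; inj₁; inj₂)
open import Data.Unit.Base using (⊤; tt)
open import Data.Vec.Base as Vec using (Vec)
open import Data.Vec.Properties using (lookup∘tabulate; length-toList)
import Data.Vec.Relation.Unary.All as VecAll
import Data.Vec.Relation.Unary.All.Properties as VecAll
open import Data.Vec.Relation.Unary.Linked using (Linked; []; [-]; _∷_)
import Data.Vec.Relation.Unary.Linked.Properties as Linked
open import Function.Base using (_∘_; id)
open import Function.Bundles using (_⇔_; mk⇔)
open import Relation.Binary.Construct.Closure.ReflexiveTransitive
  using (Star; ε; _◅_; _◅◅_; gmap)
import Relation.Binary.Construct.Closure.ReflexiveTransitive as Star
open import Relation.Binary.Definitions using (tri<; tri≈; tri>)
open import Relation.Binary.PropositionalEquality
  using (_≡_; _≢_; _≗_; refl; sym; cong; cong₂; subst; subst₂; setoid; module ≡-Reasoning)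
import Relation.Binary.PropositionalEquality as ≡
open import Relation.Nullary.Decidable using (Dec; yes; no; ¬?; _×-dec_)
open import Relation.Nullary.Negation using (¬_; contradiction)
open import Relation.Unary using (Decidable)

-- `rookSequence` accepts every list of integers, because rearranging the roots of a board passes
-- through lists that belong to no board. The obstacle in both directions is that vertices, and the
-- boards along a walk, have different numbers of columns. Padding by p columns raises every root by
-- p and adds the letters 0, ..., p - 1 once each. The added letters are unrepeated and smaller than
-- all others, so the condition survives. For sufficiency, B and the two given vertices are
-- therefore brought to one common width. For necessity the width varies along the walk, so columns
-- are counted from the right and a root z among N columns is replaced by N - 1 - z; neither sees
-- padding. The letter removed in the induction has to be the least repeated one: losing a t can
-- harm only the demand that t - 1 makes on t, and t - 1 is not repeated.

module RookNumbers where

  open import Data.List.Relation.Unary.All using (All)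

  -- Rook sequences of lists of roots and their factorisation

  module RookPolynomial where

    open import Data.Integer.Base using (_+_; _-_; _*_)
    open ≡-Reasoning

    -- The effect on the sequence of rook numbers of appending a column of height
    -- b at least that of all others: k rooks on these leave b - k of its cells.
    append : ℤ → (ℕ → ℤ) → ℕ → ℤ
    append b f zero    = f zero
    append b f (suc k) = f (suc k) + (b - + k) * f k

    empty : ℕ → ℤ
    empty zero    = 1ℤ
    empty (suc _) = 0ℤ

    -- Roots are listed from the last column to the first.
    rookSequence : List ℤ → ℕ → ℤ
    rookSequence []       = empty
    rookSequence (z ∷ zs) = append (+ length zs - z) (rookSequence zs)

    append-cong : ∀ b {f g} → f ≗ g → append b f ≗ append b g
    append-cong b f≗g zero    = f≗g zero
    append-cong b f≗g (suc k) =
      cong₂ _+_ (f≗g (suc k)) (cong ((b - + k) *_) (f≗g k))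

    -- The appended sequence has at `suc k` the value `f (suc k)` plus a known multiple of `f k`, so
    -- `f` is recovered term by term.
    append-injective : ∀ b {f g} → append b f ≗ append b g → f ≗ g
    append-injective b e zero    = e zero
    append-injective b {f} {g} e (suc k) = ∙-cancelʳ ℤ.+-0-abelianGroup ((b - + k) * f k) _ _
      (≡.trans (e (suc k)) (cong (λ t → g (suc k) + (b - + k) * t)
        (sym (append-injective b e k))))

    -- The width and the rook count both grow by one from the inner operator to the outer one. So
    -- `f₀` gets the coefficient `(n - z - k) * (n - w - k)`, and that of `f₁` is a sum symmetric in
    -- z and w.
    append-comm : ∀ n z w f →
      append (+ suc n - z) (append (+ n - w) f) ≗
      append (+ suc n - w) (append (+ n - z) f)
    append-comm n z w f zero          = refl
    append-comm n z w f (suc zero)    = lemma (+ n) z w (f 1) (f 0)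
      where
      lemma : ∀ n z w f₁ f₀ →
        (f₁ + (n - w - 0ℤ) * f₀) + ((1ℤ + n) - z - 0ℤ) * f₀ ≡
        (f₁ + (n - z - 0ℤ) * f₀) + ((1ℤ + n) - w - 0ℤ) * f₀
      lemma = ℤ.solve-∀
    append-comm n z w f (suc (suc k)) =
      lemma (+ n) z w (+ k) (f (suc (suc k))) (f (suc k)) (f k)
      where
      lemma : ∀ n z w k f₂ f₁ f₀ →
        (f₂ + (n - w - (1ℤ + k)) * f₁) + ((1ℤ + n) - z - (1ℤ + k)) * (f₁ + (n - w - k) * f₀) ≡
        (f₂ + (n - z - (1ℤ + k)) * f₁) + ((1ℤ + n) - w - (1ℤ + k)) * (f₁ + (n - z - k) * f₀)
      lemma = ℤ.solve-∀

    rookSequence-↭ : ∀ {zs ws} → zs ↭ ws → rookSequence zs ≗ rookSequence ws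
    rookSequence-↭ refl k = refl
    rookSequence-↭ (prep {zs} {ws} z p) k
      rewrite ↭-length p = append-cong (+ length ws - z) (rookSequence-↭ p) k
    rookSequence-↭ (swap {zs} {ws} z w p) k
      rewrite ↭-length p = ≡.trans
        (append-cong (+ suc n - z) (append-cong (+ n - w) (rookSequence-↭ p)) k)
        (append-comm n z w (rookSequence ws) k)
      where n = length ws
    rookSequence-↭ (trans p q) k =
      ≡.trans (rookSequence-↭ p k) (rookSequence-↭ q k)

    -- Horner form of Σ_{k ≤ m} f k · x (x - 1) ⋯ (x - (m - k) + 1).
    eval : ℕ → (ℕ → ℤ) → ℤ → ℤ
    eval zero    f x = f zero
    eval (suc m) f x = f (suc m) + x * eval m f (x - 1ℤ)

    eval-cong : ∀ m {f g} → f ≗ g → eval m f ≗ eval m g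
    eval-cong zero    f≗g x = f≗g zero
    eval-cong (suc m) f≗g x =
      cong₂ _+_ (f≗g (suc m)) (cong (x *_) (eval-cong m f≗g (x - 1ℤ)))

    -- In the term of `f k` the longer falling factorial contributes a factor x - (m - k) and the
    -- new column a factor b - k. Their sum x + b - m is free of k and can be taken out.
    eval-append : ∀ m b f x →
      eval (suc m) (append b f) x ≡ f (suc m) + (x + b - + m) * eval m f x
    eval-append zero b f x = lemma b x (f 1) (f 0)
      where
      lemma : ∀ b x f₁ f₀ →
        (f₁ + (b - 0ℤ) * f₀) + x * f₀ ≡ f₁ + (x + b - 0ℤ) * f₀
      lemma = ℤ.solve-∀
    eval-append (suc m) b f x = begin
      append b f (suc (suc m)) + x * eval (suc m) (append b f) (x - 1ℤ)
        ≡⟨ cong (λ t → append b f (suc (suc m)) + x * t) (eval-append m b f (x - 1ℤ)) ⟩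
      append b f (suc (suc m)) + x * (f (suc m) + (x - 1ℤ + b - + m) * eval m f (x - 1ℤ))
        ≡⟨ lemma b x (+ m) (f (suc (suc m))) (f (suc m)) (eval m f (x - 1ℤ)) ⟩
      f (suc (suc m)) + (x + b - + suc m) * eval (suc m) f x ∎
      where
      lemma : ∀ b x m f₂ f₁ e →
        (f₂ + (b - (1ℤ + m)) * f₁) + x * (f₁ + (x - 1ℤ + b - m) * e) ≡
        f₂ + (x + b - (1ℤ + m)) * (f₁ + x * e)
      lemma = ℤ.solve-∀

    rookSequence-vanishes : ∀ zs k → length zs ℕ.< k → rookSequence zs k ≡ 0ℤ
    rookSequence-vanishes []       (suc k) _ = refl
    rookSequence-vanishes (z ∷ zs) (suc k) (s≤s zs<k)
      rewrite rookSequence-vanishes zs (suc k) (ℕ.m<n⇒m<1+n zs<k)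
            | rookSequence-vanishes zs k zs<k
            | ℤ.*-zeroʳ (+ length zs - z - + k) = refl

    eval-rookSequence-∷ : ∀ z zs x →
      eval (length (z ∷ zs)) (rookSequence (z ∷ zs)) x ≡
      (x - z) * eval (length zs) (rookSequence zs) x
    eval-rookSequence-∷ z zs x = ≡.trans
      (eval-append (length zs) _ (rookSequence zs) x)
      (≡.trans (cong (_+ (x + b - + length zs) * e) (rookSequence-vanishes zs (suc (length zs)) ℕ.≤-refl))
        (lemma x z (+ length zs) e))
      where
      b = + length zs - z
      e = eval (length zs) (rookSequence zs) x

      lemma : ∀ x z n e → 0ℤ + (x + (n - z) - n) * e ≡ (x - z) * e
      lemma = ℤ.solve-∀

    eval-zero⇒root : ∀ zs x → eval (length zs) (rookSequence zs) x ≡ 0ℤ → x ∈ zs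
    eval-zero⇒root (z ∷ zs) x e
      with ℤ.i*j≡0⇒i≡0∨j≡0 (x - z) (≡.trans (sym (eval-rookSequence-∷ z zs x)) e)
    ... | inj₁ x-z≡0 = here (ℤ.i-j≡0⇒i≡j x z x-z≡0)
    ... | inj₂ rest  = there (eval-zero⇒root zs x rest)

    ∈⇒↭∷ : ∀ {A : Set} {x : A} {xs} → x ∈ xs → ∃[ ys ] xs ↭ x ∷ ys
    ∈⇒↭∷ x∈xs with ys , zs , refl ← ∈-∃++ x∈xs = _ , shift _ ys zs

    -- The evaluation of `zs` vanishes at its head z, hence so does that of `ws`, and a product of
    -- integers x - w that is zero at z has z among its roots. With z moved to the front of `ws`,
    -- `append` can be cancelled.
    rookSequence-injective : ∀ zs ws → length zs ≡ length ws →
      rookSequence zs ≗ rookSequence ws → zs ↭ ws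
    rookSequence-injective []       []       _ _  = refl
    rookSequence-injective (z ∷ zs) ws       l e  =
      trans (prep z (rookSequence-injective zs ws′ l′ e′)) (↭-sym ws↭)
      where
      z-root : eval (length ws) (rookSequence ws) z ≡ 0ℤ
      z-root = begin
        eval (length ws) (rookSequence ws) z             ≡⟨ cong (λ n → eval n (rookSequence ws) z) l ⟨
        eval (length (z ∷ zs)) (rookSequence ws) z       ≡⟨ eval-cong (length (z ∷ zs)) e z ⟨
        eval (length (z ∷ zs)) (rookSequence (z ∷ zs)) z ≡⟨ eval-rookSequence-∷ z zs z ⟩
        (z - z) * eval (length zs) (rookSequence zs) z
          ≡⟨ cong (_* eval (length zs) (rookSequence zs) z) (ℤ.+-inverseʳ z) ⟩
        0ℤ ∎

      split : ∃[ ws′ ] ws ↭ z ∷ ws′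
      split = ∈⇒↭∷ (eval-zero⇒root ws z z-root)

      ws′ = proj₁ split
      ws↭ = proj₂ split

      l′ : length zs ≡ length ws′
      l′ = ℕ.suc-injective (≡.trans l (↭-length ws↭))

      e′ : rookSequence zs ≗ rookSequence ws′
      e′ = append-injective (+ length zs - z) λ k →
        subst (λ n → rookSequence (z ∷ zs) k ≡ append (+ n - z) (rookSequence ws′) k)
          (sym l′) (≡.trans (e k) (rookSequence-↭ ws↭ k))

  open RookPolynomial

  module Complement {A : Set} where

    cross : ∀ {R : A → A → Set} xs {ys} → AllPairs R (xs ++ ys) → All (λ x → All (R x) ys) xs
    cross []       _        = []
    cross (x ∷ xs) (r ∷ rs) = All.++⁻ʳ xs r ∷ cross xs rs

    ∈-tail : ∀ {p q : A} {rs} → p ≢ q → q ∈ p ∷ rs → q ∈ rs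
    ∈-tail p≢q (here q≡p)   = contradiction (sym q≡p) p≢q
    ∈-tail p≢q (there q∈rs) = q∈rs

    complement : ∀ {ps rs : List A} → Unique ps → All (_∈ rs) ps → ∃[ qs ] rs ↭ ps ++ qs
    complement {[]}     _          _            = _ , refl
    complement {p ∷ ps} (p∉ps ∷ u) (p∈rs ∷ ps⊆rs)
      with rs′ , rs↭ ← ∈⇒↭∷ p∈rs
      with qs , rs′↭ ← complement u (All.zipWith (λ (p≢q , q∈rs) → ∈-tail p≢q (∈-resp-↭ rs↭ q∈rs)) (p∉ps , ps⊆rs))
      = qs , trans rs↭ (prep p rs′↭)

  length-filter-map : ∀ {A B : Set} {P : B → Set} {Q : A → Set} {f : A → B}
    (P? : Decidable P) (Q? : Decidable Q) →
    (∀ {x} → P (f x) → Q x) → (∀ {x} → Q x → P (f x)) →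
    ∀ xs → length (filter P? (map f xs)) ≡ length (filter Q? xs)
  length-filter-map P? Q? P⇒Q Q⇒P [] = refl
  length-filter-map {f = f} P? Q? P⇒Q Q⇒P (x ∷ xs) with P? (f x) | Q? x
  ... | yes _  | yes _  = cong suc (length-filter-map P? Q? P⇒Q Q⇒P xs)
  ... | no _   | no _   = length-filter-map P? Q? P⇒Q Q⇒P xs
  ... | yes Pf | no ¬Q  = contradiction (P⇒Q Pf) ¬Q
  ... | no ¬Pf | yes Qx = contradiction (Q⇒P Qx) ¬Pf

  -- Counting placements column by column

  module Placements {n : ℕ} where

    open ≡-Reasoning
    open Complement

    Compatible : Cell n → Cell n → Set
    Compatible (i , r) (j , s) = i ≢ j × r ≢ s

    compatible? : ∀ c d → Dec (Compatible c d)
    compatible? (i , r) (j , s) = ¬? (i Fin.≟ j) ×-dec ¬? (r ℕ.≟ s)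

    Extends : List (Cell n) → List (Cell n) → Set
    Extends p ys = All (λ y → All (Compatible y) p) ys × NonAttacking ys

    extends? : ∀ p ys → Dec (Extends p ys)
    extends? p ys = all? (λ y → all? (compatible? y) p) ys ×-dec nonAttacking? ys

    Compatible-sym : ∀ {c d} → Compatible c d → Compatible d c
    Compatible-sym (i≢j , r≢s) = i≢j ∘ sym , r≢s ∘ sym

    extends-∷⁺ : ∀ {p x ys} → All (Compatible x) p → Extends (x ∷ p) ys → Extends p (x ∷ ys)
    extends-∷⁺ x~p (ys~xp , ys!) =
      x~p ∷ All.map All.tail ys~xp , All.map (Compatible-sym ∘ All.head) ys~xp ∷ ys!

    extends-∷⁻ : ∀ {p x ys} → Extends p (x ∷ ys) → Extends (x ∷ p) ys
    extends-∷⁻ (_ ∷ ys~p , x~ys ∷ ys!) =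
      All.zipWith (λ (x~y , y~p) → Compatible-sym x~y ∷ y~p) (x~ys , ys~p) , ys!

    opaque

      -- Counts the ways to add k rooks from `xs` to rooks `p` already placed. With `p` as a
      -- parameter, placing the first cell of `xs` leads to another instance, with that cell moved
      -- to `p`. Outside the opaque block only the recurrences are visible.
      extensions : ℕ → List (Cell n) → List (Cell n) → ℕ
      extensions k p xs = length (filter (extends? p) (choose k xs))

      extensions-zero : ∀ p xs → extensions 0 p xs ≡ 1
      extensions-zero p xs = refl

      extensions-[] : ∀ k p → extensions (suc k) p [] ≡ 0
      extensions-[] k p = refl

      extensions-∷ : ∀ k p x xs → extensions (suc k) p (x ∷ xs) ≡
        length (filter (extends? p) (map (x ∷_) (choose k xs))) ℕ.+ extensions (suc k) p xs
      extensions-∷ k p x xs = ≡.trans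
        (cong length (filter-++ (extends? p) (map (x ∷_) (choose k xs)) (choose (suc k) xs)))
        (length-++ (filter (extends? p) (map (x ∷_) (choose k xs))))

      extensions-accept : ∀ k {p x} xs → All (Compatible x) p →
        extensions (suc k) p (x ∷ xs) ≡ extensions k (x ∷ p) xs ℕ.+ extensions (suc k) p xs
      extensions-accept k {p} {x} xs x~p =
        ≡.trans (extensions-∷ k p x xs) (cong (ℕ._+ extensions (suc k) p xs)
          (length-filter-map (extends? p) (extends? (x ∷ p)) extends-∷⁻ (extends-∷⁺ x~p) (choose k xs)))

      extensions-reject : ∀ k {p x} xs → ¬ All (Compatible x) p →
        extensions (suc k) p (x ∷ xs) ≡ extensions (suc k) p xs
      extensions-reject k {p} {x} xs x≁p =
        ≡.trans (extensions-∷ k p x xs) (cong (ℕ._+ extensions (suc k) p xs) (cong length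
          (filter-none (extends? p) (All.map⁺ (All.universal (λ _ → x≁p ∘ All.head ∘ proj₁) (choose k xs))))))

      rookNumber≡extensions : ∀ k (B : FerrersBoard n) → rookNumber k B ≡ extensions k [] (cells B)
      rookNumber≡extensions k B = cong length (filter-≐ nonAttacking? (extends? [])
        ((λ a → All.universal (λ _ → []) _ , a) , proj₂) (choose k (cells B)))

    extensions-blocked : ∀ k {p xs} → All (λ x → ¬ All (Compatible x) p) xs →
      extensions (suc k) p xs ≡ 0
    extensions-blocked k []           = extensions-[] k _
    extensions-blocked k {xs = x ∷ xs} (x≁p ∷ xs≁p) =
      ≡.trans (extensions-reject k xs x≁p) (extensions-blocked k xs≁p)

    column : Fin n → ℕ → List (Cell n)
    column i b = map (i ,_) (applyUpTo suc b)

    extensions-sameColumn : ∀ k p i rs → extensions (suc (suc k)) p (map (i ,_) rs) ≡ 0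
    extensions-sameColumn k p i []       = extensions-[] (suc k) p
    extensions-sameColumn k p i (r ∷ rs) with all? (compatible? (i , r)) p
    ... | yes c = ≡.trans (extensions-accept (suc k) (map (i ,_) rs) c) (cong₂ ℕ._+_
      (extensions-blocked k (All.map⁺ (All.universal (λ _ a → proj₁ (All.head a) refl) rs)))
      (extensions-sameColumn k p i rs))
    ... | no ¬c = ≡.trans (extensions-reject (suc k) (map (i ,_) rs) ¬c) (extensions-sameColumn k p i rs)

    free? : ∀ (ps : List ℕ) r → Dec (All (r ≢_) ps)
    free? ps r = all? (λ p → ¬? (r ℕ.≟ p)) ps

    extensions-one : ∀ p i rs → All ((i ≢_) ∘ proj₁) p →
      extensions 1 p (map (i ,_) rs) ≡ length (filter (free? (map proj₂ p)) rs)
    extensions-one p i []       i∉p = extensions-[] 0 p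
    extensions-one p i (r ∷ rs) i∉p with free? (map proj₂ p) r
    ... | yes f = ≡.trans
      (extensions-accept 0 (map (i ,_) rs) (All.zipWith id (i∉p , All.map⁻ f)))
      (cong₂ ℕ._+_ (extensions-zero ((i , r) ∷ p) (map (i ,_) rs)) (extensions-one p i rs i∉p))
    ... | no ¬f = ≡.trans
      (extensions-reject 0 (map (i ,_) rs) (λ c → ¬f (All.map⁺ (All.map proj₂ c))))
      (extensions-one p i rs i∉p)

    record Left (i : Fin n) (b : ℕ) (c : Cell n) : Set where
      constructor left
      field
        column-≢ : i ≢ proj₁ c
        row-∈    : proj₂ c ∈ applyUpTo suc b

    -- The rows `ps` are distinct and lie within the column, so each of them blocks exactly one
    -- cell.
    length-free : ∀ ps b → Unique ps → All (_∈ applyUpTo suc b) ps →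
      length (filter (free? ps) (applyUpTo suc b)) ℕ.+ length ps ≡ b
    length-free ps b ps! ps⊆ with qs , rs↭ ← complement ps! ps⊆ = begin
      length (filter (free? ps) (applyUpTo suc b)) ℕ.+ length ps
        ≡⟨ cong (ℕ._+ length ps) (↭-length (filter-↭ (free? ps) rs↭)) ⟩
      length (filter (free? ps) (ps ++ qs)) ℕ.+ length ps
        ≡⟨ cong (λ l → length l ℕ.+ length ps) (filter-++ (free? ps) ps qs) ⟩
      length (filter (free? ps) ps ++ filter (free? ps) qs) ℕ.+ length ps
        ≡⟨ cong₂ (λ l m → length (l ++ m) ℕ.+ length ps)
             (filter-none (free? ps) (All.tabulate λ p∈ps f → All.lookup f p∈ps refl))
             (filter-all (free? ps) qs-free) ⟩
      length qs ℕ.+ length ps       ≡⟨ ℕ.+-comm (length qs) _ ⟩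
      length ps ℕ.+ length qs       ≡⟨ length-++ ps ⟨
      length (ps ++ qs)           ≡⟨ ↭-length rs↭ ⟨
      length (applyUpTo suc b)    ≡⟨ length-applyUpTo suc b ⟩
      b                           ∎
      where
      ps++qs! : Unique (ps ++ qs)
      ps++qs! = Unique-resp-↭ (setoid ℕ) (↭⇒↭ₛ rs↭)
        (applyUpTo⁺₁ suc b (λ i<j _ → ℕ.<⇒≢ i<j ∘ ℕ.suc-injective))

      qs-free : All (λ q → All (q ≢_) ps) qs
      qs-free = All.map (All.map (_∘ sym)) (All.All-swap (cross ps ps++qs!))

    -- At most one of the k + 1 rooks stands in the new column. If one does, the other
    -- `length p + k` rooks occupy distinct rows that all meet this column, by `Left`, and so leave
    -- `b - length p - k` cells. That integer can be negative only where `extensions k p xs` is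
    -- zero.
    extensions-column : ∀ k p xs i b →
      NonAttacking p → All (Left i b) p → All (Left i b) xs →
      + extensions (suc k) p (xs ++ column i b) ≡
      + extensions (suc k) p xs +ᶻ (+ b -ᶻ + length p -ᶻ + k) *ᶻ + extensions k p xs
    extensions-column zero p [] i b p! p-left _ = begin
      + extensions 1 p (column i b)
        ≡⟨ cong +_ (extensions-one p i (applyUpTo suc b) (All.map Left.column-≢ p-left)) ⟩
      + c
        ≡⟨ lemma (+ c) (+ length p) ⟩
      0ℤ +ᶻ (+ (c ℕ.+ length p) -ᶻ + length p -ᶻ 0ℤ) *ᶻ 1ℤ
        ≡⟨ cong (λ t → 0ℤ +ᶻ (+ t -ᶻ + length p -ᶻ 0ℤ) *ᶻ 1ℤ) free ⟩
      0ℤ +ᶻ (+ b -ᶻ + length p -ᶻ 0ℤ) *ᶻ 1ℤ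
        ≡⟨ cong₂ (λ s t → + s +ᶻ (+ b -ᶻ + length p -ᶻ 0ℤ) *ᶻ + t) (extensions-[] 0 p) (extensions-zero p []) ⟨
      + extensions 1 p [] +ᶻ (+ b -ᶻ + length p -ᶻ 0ℤ) *ᶻ + extensions 0 p [] ∎
      where
      c = length (filter (free? (map proj₂ p)) (applyUpTo suc b))

      free : c ℕ.+ length p ≡ b
      free = ≡.trans (cong (c ℕ.+_) (sym (length-map proj₂ p)))
        (length-free (map proj₂ p) b (AllPairs.map⁺ (AllPairs.map proj₂ p!))
          (All.map⁺ (All.map Left.row-∈ p-left)))

      lemma : ∀ c m → c ≡ 0ℤ +ᶻ ((c +ᶻ m) -ᶻ m -ᶻ 0ℤ) *ᶻ 1ℤ
      lemma = ℤ.solve-∀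
    extensions-column (suc k) p [] i b p! p-left _
      rewrite extensions-sameColumn k p i (applyUpTo suc b) | extensions-[] k p | extensions-[] (suc k) p
      = lemma (+ b) (+ length p) (+ suc k)
      where
      lemma : ∀ b m k → 0ℤ ≡ 0ℤ +ᶻ (b -ᶻ m -ᶻ k) *ᶻ 0ℤ
      lemma = ℤ.solve-∀
    extensions-column k p (x ∷ xs) i b p! p-left (x-left ∷ xs-left)
      with all? (compatible? x) p
    extensions-column zero p (x ∷ xs) i b p! p-left (x-left ∷ xs-left) | yes x~p
      rewrite extensions-accept 0 xs x~p
            | extensions-accept 0 (xs ++ column i b) x~p
            | extensions-zero (x ∷ p) xs
            | extensions-zero (x ∷ p) (xs ++ column i b)
            | extensions-zero p (x ∷ xs)
      = begin
      1ℤ +ᶻ + extensions 1 p (xs ++ column i b)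
        ≡⟨ cong (1ℤ +ᶻ_) (extensions-column zero p xs i b p! p-left xs-left) ⟩
      1ℤ +ᶻ (+ extensions 1 p xs +ᶻ (+ b -ᶻ + length p -ᶻ 0ℤ) *ᶻ + extensions 0 p xs)
        ≡⟨ cong (λ t → 1ℤ +ᶻ (+ extensions 1 p xs +ᶻ (+ b -ᶻ + length p -ᶻ 0ℤ) *ᶻ + t)) (extensions-zero p xs) ⟩
      1ℤ +ᶻ (+ extensions 1 p xs +ᶻ (+ b -ᶻ + length p -ᶻ 0ℤ) *ᶻ 1ℤ)
        ≡⟨ ℤ.+-assoc 1ℤ (+ extensions 1 p xs) ((+ b -ᶻ + length p -ᶻ 0ℤ) *ᶻ 1ℤ) ⟨
      (1ℤ +ᶻ + extensions 1 p xs) +ᶻ (+ b -ᶻ + length p -ᶻ 0ℤ) *ᶻ 1ℤ ∎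
    extensions-column (suc k) p (x ∷ xs) i b p! p-left (x-left ∷ xs-left) | yes x~p
      rewrite extensions-accept (suc k) xs x~p
            | extensions-accept (suc k) (xs ++ column i b) x~p
            | extensions-accept k xs x~p
      -- Placing `x` lengthens `p` by one and lowers k by one, so both induction hypotheses carry
      -- the same factor.
      = ≡.trans
        (cong₂ _+ᶻ_
          (extensions-column k (x ∷ p) xs i b (x~p ∷ p!) (x-left ∷ p-left) xs-left)
          (extensions-column (suc k) p xs i b p! p-left xs-left))
        (lemma (+ b) (+ length p) (+ k) (+ extensions (suc k) (x ∷ p) xs)
          (+ extensions (suc (suc k)) p xs) (+ extensions k (x ∷ p) xs) (+ extensions (suc k) p xs))
      where
      lemma : ∀ b m k x₁ x₂ y₁ y₂ →
        (x₁ +ᶻ (b -ᶻ (1ℤ +ᶻ m) -ᶻ k) *ᶻ y₁) +ᶻ (x₂ +ᶻ (b -ᶻ m -ᶻ (1ℤ +ᶻ k)) *ᶻ y₂) ≡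
        (x₁ +ᶻ x₂) +ᶻ (b -ᶻ m -ᶻ (1ℤ +ᶻ k)) *ᶻ (y₁ +ᶻ y₂)
      lemma = ℤ.solve-∀
    extensions-column zero p (x ∷ xs) i b p! p-left (x-left ∷ xs-left) | no x≁p
      rewrite extensions-reject 0 xs x≁p
            | extensions-reject 0 (xs ++ column i b) x≁p
            | ≡.trans (extensions-zero p (x ∷ xs)) (sym (extensions-zero p xs))
      = extensions-column zero p xs i b p! p-left xs-left
    extensions-column (suc k) p (x ∷ xs) i b p! p-left (x-left ∷ xs-left) | no x≁p
      rewrite extensions-reject (suc k) xs x≁p
            | extensions-reject (suc k) (xs ++ column i b) x≁p
            | extensions-reject k xs x≁p
      = extensions-column (suc k) p xs i b p! p-left xs-left

  -- Column heights are listed from the last column to the first.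
  roots : List ℕ → List ℤ
  roots []       = []
  roots (b ∷ bs) = (+ length bs -ᶻ + b) ∷ roots bs

  length-roots : ∀ bs → length (roots bs) ≡ length bs
  length-roots []       = refl
  length-roots (b ∷ bs) = cong suc (length-roots bs)

  -- The rook numbers of a board from its roots

  module _ {n : ℕ} (B : FerrersBoard n) where

    open Placements

    private
      col : Fin n → List (Cell n)
      col i = column i (height B i)

    -- Cells come column by column from the left while `roots` reads from the right, so the heights
    -- already processed accumulate in `bs`. The last hypothesis keeps the cells present so far
    -- outside every column to come and within its rows, as `extensions-column` requires.
    extensions-columns : ∀ is xs bs →
      (∀ k → + extensions k [] xs ≡ rookSequence (roots bs) k) →
      AllPairs (λ i j → height B i ℕ.≤ height B j × i ≢ j) is →
      All (λ i → All (Left i (height B i)) xs) is →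
      ∀ k → + extensions k [] (xs ++ concatMap col is) ≡
            rookSequence (roots (map (height B) is ʳ++ bs)) k
    extensions-columns []       xs bs xs-bs _ _ k
      rewrite ++-identityʳ xs = xs-bs k
    extensions-columns (i ∷ is) xs bs xs-bs (i≤is ∷ is↗) (xs-left ∷ xs-lefts) k
      rewrite sym (++-assoc xs (col i) (concatMap col is))
      = extensions-columns is (xs ++ col i) (height B i ∷ bs) step is↗
          (All.zipWith (λ (lefts , b≤ , i≢) → All.++⁺ lefts (col-left b≤ i≢)) (xs-lefts , i≤is)) k
      where
      b = height B i

      step : ∀ k → + extensions k [] (xs ++ col i) ≡ rookSequence (roots (b ∷ bs)) k
      step zero    = ≡.trans
        (cong +_ (≡.trans (extensions-zero [] (xs ++ col i)) (sym (extensions-zero [] xs))))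
        (xs-bs zero)
      step (suc k) = ≡.trans (extensions-column k [] xs i b [] [] xs-left)
        (cong₂ _+ᶻ_ (xs-bs (suc k)) (cong₂ _*ᶻ_ head-height (xs-bs k)))
        where
        lemma : ∀ n b k → b -ᶻ 0ℤ -ᶻ k ≡ n -ᶻ (n -ᶻ b) -ᶻ k
        lemma = ℤ.solve-∀

        head-height : + b -ᶻ 0ℤ -ᶻ + k ≡ + length (roots bs) -ᶻ (+ length bs -ᶻ + b) -ᶻ + k
        head-height rewrite length-roots bs = lemma (+ length bs) (+ b) (+ k)

      col-left : ∀ {j} → b ℕ.≤ height B j → i ≢ j → All (Left j (height B j)) (col i)
      col-left b≤ i≢j = All.map⁺ (All.applyUpTo⁺₁ suc b λ r<b →
        left (i≢j ∘ sym) (∈-applyUpTo⁺ suc (ℕ.<-≤-trans r<b b≤)))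

    rookNumber≡rookSequence : ∀ k →
      + rookNumber k B ≡ rookSequence (roots (reverse (Vec.toList (heights B)))) k
    rookNumber≡rookSequence k = begin
      + rookNumber k B
        ≡⟨ cong +_ (rookNumber≡extensions k B) ⟩
      + extensions k [] (cells B)
        ≡⟨ extensions-columns (allFin n) [] [] no-cells
             (AllPairs.tabulate⁺-< λ i<j → Linked.lookup⁺ ℕ.≤-trans (increasing B) i<j , Fin.<⇒≢ i<j)
             (All.universal (λ _ → []) (allFin n)) k ⟩
      rookSequence (roots (reverse (map (height B) (allFin n)))) k
        ≡⟨ cong (λ hs → rookSequence (roots (reverse hs)) k) (map-lookup (heights B)) ⟩
      rookSequence (roots (reverse (Vec.toList (heights B)))) k ∎
      where
      open ≡-Reasoning

      no-cells : ∀ k → + extensions k [] [] ≡ rookSequence [] k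
      no-cells zero    = cong +_ (extensions-zero [] [])
      no-cells (suc k) = cong +_ (extensions-[] k [])

      map-lookup : ∀ {n} (v : Vec.Vec ℕ n) → map (Vec.lookup v) (allFin n) ≡ Vec.toList v
      map-lookup Vec.[]      = refl
      map-lookup (x Vec.∷ v) = cong (x ∷_) (≡.trans
        (map-tabulate Fin.suc (Vec.lookup (x Vec.∷ v)))
        (≡.trans (sym (map-tabulate id (Vec.lookup v))) (map-lookup v)))

open RookNumbers
open RookPolynomial

module BoardsAsWords where

  open import Data.List.Relation.Unary.All using (All)
  open import Data.List.Sort ℕ.≤-decTotalOrder using (sort; sort-↭; sort-↗)
  open import Data.Nat.Base
  open import Data.Nat.Induction using (<-rec)
  open import Data.Nat.Properties
  open import Data.Nat.Tactic.RingSolver using (solve-∀)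

  -- Words that rise by at most one, and their connectedness

  module Words where

    applyDownFrom-cong : ∀ {A : Set} {f g : ℕ → A} N → (∀ {j} → j < N → f j ≡ g j) →
      applyDownFrom f N ≡ applyDownFrom g N
    applyDownFrom-cong zero    f≗g = refl
    applyDownFrom-cong (suc N) f≗g = cong₂ _∷_ (f≗g ≤-refl) (applyDownFrom-cong N (f≗g ∘ m<n⇒m<1+n))

    count : ℕ → List ℕ → ℕ
    count k l = length (filter (k ≟_) l)

    count-↭ : ∀ k {l m} → l ↭ m → count k l ≡ count k m
    count-↭ k p = ↭-length (filter-↭ (k ≟_) p)

    count-≡ : ∀ k l → count k (k ∷ l) ≡ suc (count k l)
    count-≡ k l = cong length (filter-accept (k ≟_) {xs = l} refl)

    count-≢ : ∀ {k x} l → k ≢ x → count k (x ∷ l) ≡ count k l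
    count-≢ {k} l k≢x = cong length (filter-reject (k ≟_) {xs = l} k≢x)

    Repeated : (ℕ → ℕ) → ℕ → ℕ → Set
    Repeated f N k = ∃[ i ] ∃[ j ] i < j × j < N × f i ≡ k × f j ≡ k

    occurs : ∀ f N k → 1 ≤ count k (applyDownFrom f N) → ∃[ i ] i < N × f i ≡ k
    occurs f (suc N) k c with k ≟ f N
    ... | yes k≡fN = N , ≤-refl , sym k≡fN
    ... | no k≢fN
      with i , i<N , fi≡k ← occurs f N k (subst (1 ≤_) (count-≢ (applyDownFrom f N) k≢fN) c)
      = i , m<n⇒m<1+n i<N , fi≡k

    count≥1 : ∀ f N {i} → i < N → 1 ≤ count (f i) (applyDownFrom f N)
    count≥1 f (suc N) {i} i<1+N with f i ≟ f N
    ... | yes fi≡fN = subst (λ k → 1 ≤ count k (applyDownFrom f (suc N))) (sym fi≡fN)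
      (subst (1 ≤_) (sym (count-≡ (f N) (applyDownFrom f N))) (s≤s z≤n))
    ... | no fi≢fN = subst (1 ≤_) (sym (count-≢ (applyDownFrom f N) fi≢fN))
      (count≥1 f N (≤∧≢⇒< (s≤s⁻¹ i<1+N) (fi≢fN ∘ cong f)))

    count≥2⇒repeated : ∀ f N k → 2 ≤ count k (applyDownFrom f N) → Repeated f N k
    count≥2⇒repeated f (suc N) k c with k ≟ f N
    ... | yes refl
      with i , i<N , fi≡k ← occurs f N k (s≤s⁻¹ (subst (2 ≤_) (count-≡ k (applyDownFrom f N)) c))
      = i , N , i<N , ≤-refl , fi≡k , refl
    ... | no k≢fN
      with i , j , i<j , j<N , e ← count≥2⇒repeated f N k (subst (2 ≤_) (count-≢ (applyDownFrom f N) k≢fN) c)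
      = i , j , i<j , m<n⇒m<1+n j<N , e

    repeated⇒count≥2 : ∀ f N k → Repeated f N k → 2 ≤ count k (applyDownFrom f N)
    repeated⇒count≥2 f (suc N) k (i , j , i<j , j<1+N , refl , fj≡fi) with f i ≟ f N
    ... | yes fi≡fN = subst (λ k → 2 ≤ count k (applyDownFrom f (suc N))) (sym fi≡fN)
      (subst (2 ≤_) (sym (count-≡ (f N) (applyDownFrom f N)))
        (s≤s (subst (λ k → 1 ≤ count k (applyDownFrom f N)) fi≡fN
          (count≥1 f N (<-≤-trans i<j (s≤s⁻¹ j<1+N))))))
    ... | no fi≢fN = subst (2 ≤_) (sym (count-≢ (applyDownFrom f N) fi≢fN))
      (repeated⇒count≥2 f N (f i)
        (i , j , i<j , ≤∧≢⇒< (s≤s⁻¹ j<1+N) (λ { refl → fi≢fN (sym fj≡fi) }) , refl , fj≡fi))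

    -- The letter at j is the root of column j: its height j ∸ f j starts at 0 and
    -- weakly increases.
    record Valid (N : ℕ) (f : ℕ → ℕ) : Set where
      field
        start : 0 < N → f 0 ≡ 0
        step  : ∀ {j} → suc j < N → f (suc j) ≤ suc (f j)

    open Valid public

    -- A discrete intermediate value theorem: from 0 with rises of at most 1, no value up to `f j`
    -- can be skipped.
    passes : ∀ {N f} → Valid N f → ∀ {j u} → j < N → u ≤ f j → ∃[ i ] i ≤ j × f i ≡ u
    passes {f = f} v {zero}  {u} 0<N u≤f0 =
      0 , z≤n , ≡.trans (start v 0<N) (sym (n≤0⇒n≡0 (subst (u ≤_) (start v 0<N) u≤f0)))
    passes {f = f} v {suc j} {u} 1+j<N u≤f with u ≟ f (suc j)
    ... | yes u≡f = suc j , ≤-refl , sym u≡f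
    ... | no u≢f with i , i≤j , fi≡u ← passes v (<⇒≤ 1+j<N) (s≤s⁻¹ (≤-trans (≤∧≢⇒< u≤f u≢f) (step v 1+j<N)))
      = i , m≤n⇒m≤1+n i≤j , fi≡u

    passes-before : ∀ {N f} → Valid N f → ∀ {j u} → j < N → u < f j → ∃[ i ] i < j × f i ≡ u
    passes-before v {j} j<N u<fj with i , i≤j , refl ← passes v j<N (<⇒≤ u<fj) =
      i , ≤∧≢⇒< i≤j (λ { refl → <-irrefl refl u<fj }) , refl

    letter≤index : ∀ {N f} → Valid N f → ∀ {j} → j < N → f j ≤ j
    letter≤index v {zero}  0<N = ≤-reflexive (start v 0<N)
    letter≤index v {suc j} j<N = ≤-trans (step v j<N) (s≤s (letter≤index v (<⇒≤ j<N)))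

    infixl 9 _[_≔_]
    opaque

      _[_≔_] : (ℕ → ℕ) → ℕ → ℕ → ℕ → ℕ
      (f [ i ≔ x ]) j with j ≟ i
      ... | yes _ = x
      ... | no  _ = f j

      update-≡ : ∀ f i x → (f [ i ≔ x ]) i ≡ x
      update-≡ f i x with i ≟ i
      ... | yes _ = refl
      ... | no i≢i = contradiction refl i≢i

      update-≢ : ∀ f {i j} x → j ≢ i → (f [ i ≔ x ]) j ≡ f j
      update-≢ f {i} {j} x j≢i with j ≟ i
      ... | yes j≡i = contradiction j≡i j≢i
      ... | no _ = refl

    record Swapped (N : ℕ) (f g : ℕ → ℕ) : Set where
      field
        {i j}     : ℕ
        i<j       : i < j
        j<N       : j < N
        differ    : f i ≢ f j
        at-i      : g i ≡ f j
        at-j      : g j ≡ f i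
        elsewhere : ∀ {l} → l < N → l ≢ i → l ≢ j → g l ≡ f l

    Swapped-sym : ∀ {N f g} → Swapped N f g → Swapped N g f
    Swapped-sym s = record
      { i<j       = i<j
      ; j<N       = j<N
      ; differ    = λ gi≡gj → differ (sym (≡.trans (sym at-i) (≡.trans gi≡gj at-j)))
      ; at-i      = sym at-j
      ; at-j      = sym at-i
      ; elsewhere = λ l<N l≢i l≢j → sym (elsewhere l<N l≢i l≢j)
      } where open Swapped s

    replace-↭ : ∀ {f g} N {p} → p < N → (∀ {l} → l < N → l ≢ p → g l ≡ f l) →
      Σ[ rest ∈ List ℕ ] applyDownFrom f N ↭ f p ∷ rest × applyDownFrom g N ↭ g p ∷ rest
    replace-↭ {f} {g} (suc N) {p} p<1+N g≗f with p ≟ N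
    ... | yes refl = applyDownFrom f N , refl , ↭-reflexive
      (cong (g N ∷_) (applyDownFrom-cong N λ j<N → g≗f (m<n⇒m<1+n j<N) (<⇒≢ j<N)))
    ... | no p≢N with rest , f↭ , g↭ ← replace-↭ {f} {g} N (≤∧≢⇒< (s≤s⁻¹ p<1+N) p≢N) (g≗f ∘ m<n⇒m<1+n)
      = f N ∷ rest , trans (prep (f N) f↭) (swap _ _ refl)
      , trans (↭-reflexive (cong (_∷ applyDownFrom g N) (g≗f ≤-refl (p≢N ∘ sym))))
          (trans (prep (f N) g↭) (swap _ _ refl))

    swap-last-↭ : ∀ {f g N p} → p < N → g p ≡ f N → g N ≡ f p →
      (∀ {l} → l < N → l ≢ p → g l ≡ f l) →
      applyDownFrom g (suc N) ↭ applyDownFrom f (suc N)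
    swap-last-↭ {f} {g} {N} {p} p<N gp≡fN gN≡fp g≗f with rest , f↭ , g↭ ← replace-↭ {f} {g} N p<N g≗f
      rewrite gp≡fN | gN≡fp =
      trans (prep (f p) g↭) (trans (swap (f p) (f N) refl) (prep (f N) (↭-sym f↭)))

    record Word (w : List ℕ) (N : ℕ) : Set where
      field
        letter  : ℕ → ℕ
        valid   : Valid N letter
        content : applyDownFrom letter N ↭ w

    open Word public

    -- Letters from N onwards carry no meaning, so words that agree below N present the same board
    -- and are joined as well.
    Edge : ∀ {w N} → Word w N → Word w N → Set
    Edge {N = N} X Y = (∀ {j} → j < N → letter X j ≡ letter Y j) ⊎ Swapped N (letter X) (letter Y)

    Edge-sym : ∀ {w N} {X Y : Word w N} → Edge X Y → Edge Y X
    Edge-sym (inj₁ X≗Y) = inj₁ λ j<N → sym (X≗Y j<N)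
    Edge-sym (inj₂ s)   = inj₂ (Swapped-sym s)

    Path : ∀ {w N} → Word w N → Word w N → Set
    Path = Star Edge

    -- The condition of the theorem, with i < M - 1 expressed as the occurrence of i + 2.
    Supported : List ℕ → Set
    Supported w = ∀ i → 2 ≤ count i w → suc (suc i) ∈ w → 2 ≤ count (suc i) w

    Least : (ℕ → Set) → ℕ → Set
    Least P t = P t × (∀ {u} → u < t → ¬ P u)

    least : ∀ {P : ℕ → Set} → Decidable P → ∀ n → (∃[ t ] Least P t) ⊎ (∀ {u} → u < n → ¬ P u)
    least P? zero    = inj₂ λ ()
    least {P} P? (suc n) with least P? n
    ... | inj₁ found = inj₁ found
    ... | inj₂ none with P? n
    ...   | yes Pn = inj₁ (n , Pn , none)
    ...   | no ¬Pn = inj₂ none′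
      where
      none′ : ∀ {u} → u < suc n → ¬ P u
      none′ {u} u<1+n with u ≟ n
      ... | yes refl = ¬Pn
      ... | no u≢n   = none (≤∧≢⇒< (s≤s⁻¹ u<1+n) u≢n)

    -- Used between two occurrences of y: it finds an index `suc p` with a letter of at most y whose
    -- predecessor is high enough for y + 1 to follow.
    descends : ∀ (f : ℕ → ℕ) {y s} s′ → s < s′ → y ≤ f s → f s′ ≤ y →
      ∃[ p ] p < s′ × y ≤ f p × f (suc p) ≤ y
    descends f {y} {s} (suc s′) s<1+s′ y≤fs f≤y with y ≤? f s′
    ... | yes y≤f = s′ , ≤-refl , y≤f , f≤y
    ... | no y≰f with p , p<s′ , e ← descends f s′
          (≤∧≢⇒< (s≤s⁻¹ s<1+s′) (λ { refl → y≰f y≤fs })) y≤fs (<⇒≤ (≰⇒> y≰f))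
      = p , m<n⇒m<1+n p<s′ , e

    module _ {w : List ℕ} where

      repeated : ∀ {N k} (X : Word w N) → 2 ≤ count k w → Repeated (letter X) N k
      repeated {N} {k} X c = count≥2⇒repeated (letter X) N k
        (subst (2 ≤_) (sym (count-↭ k (content X))) c)

      repeated⁻¹ : ∀ {N k} (X : Word w N) → Repeated (letter X) N k → 2 ≤ count k w
      repeated⁻¹ {N} {k} X r = subst (2 ≤_) (count-↭ k (content X))
        (repeated⇒count≥2 (letter X) N k r)

      module _ {t : ℕ} (t-least : Least (λ u → 2 ≤ count u w) t) where

        -- A last letter below t was already passed on the way up to the first t, and would be a
        -- repeated letter smaller than t.
        last-≥ : ∀ {N} (X : Word w (suc N)) → t ≤ letter X N
        last-≥ {N} X with t ≤? letter X N
        ... | yes t≤z = t≤z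
        ... | no t≰z
          with i , j , i<j , j<1+N , refl , _ ← repeated X (proj₁ t-least)
          with h , h<i , fh≡z ← passes-before (valid X) (<-trans i<j j<1+N) (≰⇒> t≰z)
          = contradiction
              (repeated⁻¹ X (h , N , <-≤-trans (<-trans h<i i<j) (s≤s⁻¹ j<1+N) , ≤-refl , fh≡z , refl))
              (proj₂ t-least (≰⇒> t≰z))

        -- Let the last letter be y + 1. The exchange puts it at an index q whose predecessor is at
        -- least y, so it is a legal rise there. The step out of q becomes easier because its letter
        -- grew, and the last step because the last letter fell.
        lower-last : ∀ {N} → Supported w → (X : Word w (suc N)) → t < letter X N →
          Σ[ Y ∈ Word w (suc N) ] Swapped (suc N) (letter X) (letter Y) × letter Y N < letter X N
        lower-last {N} supported X t<z = go (letter X N) refl t<z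
          where
          f = letter X

          -- A climb starting from t: as long as d + t + 2 is at most the last letter it occurs in
          -- the word, so `supported` carries repetition from d + t to d + t + 1.
          all-repeated : ∀ d → suc (d + t) ≤ f N → 2 ≤ count (d + t) w
          all-repeated zero    _ = proj₁ t-least
          all-repeated (suc d) h
            with i , i≤N , fi≡ ← passes (valid X) ≤-refl h
            = supported (d + t) (all-repeated d (<⇒≤ h))
                (∈-resp-↭ (content X) (subst (_∈ applyDownFrom f (suc N)) fi≡ (∈-applyDownFrom⁺ f (s≤s i≤N))))

          go : ∀ z → f N ≡ z → t < z → Σ[ Y ∈ Word w (suc N) ] Swapped (suc N) f (letter Y) × letter Y N < f N
          go (suc y) fN≡1+y (s≤s t≤y)
            with s , s′ , s<s′ , s′<1+N , fs≡y , fs′≡y ←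
              repeated X (subst (λ u → 2 ≤ count u w) (m∸n+n≡m t≤y)
                (all-repeated (y ∸ t) (≤-reflexive (≡.trans (cong suc (m∸n+n≡m t≤y)) (sym fN≡1+y)))))
            with p , p<s′ , y≤fp , f1+p≤y ←
              descends f s′ s<s′ (≤-reflexive (sym fs≡y)) (≤-reflexive fs′≡y)
            = record { letter = g ; valid = g-valid ; content = trans g↭f (content X) }
            , record
                { i<j = q<N ; j<N = ≤-refl
                ; differ = <⇒≢ (subst (f q <_) (sym fN≡1+y) (s≤s f1+p≤y))
                ; at-i = gq ; at-j = gN
                ; elsewhere = λ _ l≢q l≢N → ≡.trans (update-≢ (f [ q ≔ f N ]) (f q) l≢N) (update-≢ f (f N) l≢q) }
            , subst₂ _<_ (sym gN) (sym fN≡1+y) (s≤s f1+p≤y)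
            where
            q = suc p

            s′<N : s′ < N
            s′<N = ≤∧≢⇒< (s≤s⁻¹ s′<1+N) λ { refl → 1+n≢n (≡.trans (sym fN≡1+y) fs′≡y) }

            q<N : q < N
            q<N = ≤-<-trans p<s′ s′<N

            g : ℕ → ℕ
            g = f [ q ≔ f N ] [ N ≔ f q ]

            gN : g N ≡ f q
            gN = update-≡ (f [ q ≔ f N ]) N (f q)

            gq : g q ≡ f N
            gq = ≡.trans (update-≢ (f [ q ≔ f N ]) (f q) (<⇒≢ q<N)) (update-≡ f q (f N))

            g-≢ : ∀ {l} → l < N → l ≢ q → g l ≡ f l
            g-≢ l<N l≢q = ≡.trans (update-≢ (f [ q ≔ f N ]) (f q) (<⇒≢ l<N)) (update-≢ f (f N) l≢q)

            g↭f : applyDownFrom g (suc N) ↭ applyDownFrom f (suc N)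
            g↭f = swap-last-↭ q<N gq gN g-≢

            -- Below N only the letter at q changes, and it grows, so each bound `suc (f j)` of the
            -- old word implies the bound `suc (g j)` of the new one.
            f≤g : ∀ {j} → j < N → f j ≤ g j
            f≤g {j} j<N with j ≟ q
            ... | yes refl = ≤-trans f1+p≤y (≤-trans (n≤1+n y) (≤-reflexive (sym (≡.trans gq fN≡1+y))))
            ... | no j≢q   = ≤-reflexive (sym (g-≢ j<N j≢q))

            g-valid : Valid (suc N) g
            g-valid .start _ = ≡.trans (g-≢ (≤-<-trans z≤n q<N) λ ()) (start (valid X) (s≤s z≤n))
            g-valid .step {j} j<N@(s≤s 1+j≤N) with suc j ≟ N | suc j ≟ q
            ... | yes refl | _ = begin
              g N         ≡⟨ gN ⟩
              f q         ≤⟨ f1+p≤y ⟩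
              y           ≤⟨ n≤1+n y ⟩
              suc y       ≡⟨ fN≡1+y ⟨
              f N         ≤⟨ step (valid X) j<N ⟩
              suc (f j)   ≤⟨ s≤s (f≤g ≤-refl) ⟩
              suc (g j)   ∎
              where open ≤-Reasoning
            ... | no _ | yes refl = begin
              g q         ≡⟨ ≡.trans gq fN≡1+y ⟩
              suc y       ≤⟨ s≤s y≤fp ⟩
              suc (f p)   ≤⟨ s≤s (f≤g (<⇒≤ q<N)) ⟩
              suc (g p)   ∎
              where open ≤-Reasoning
            ... | no 1+j≢N | no 1+j≢q = begin
              g (suc j)   ≡⟨ g-≢ (≤∧≢⇒< 1+j≤N 1+j≢N) 1+j≢q ⟩
              f (suc j)   ≤⟨ step (valid X) j<N ⟩
              suc (f j)   ≤⟨ s≤s (f≤g 1+j≤N) ⟩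
              suc (g j)   ∎
              where open ≤-Reasoning

        -- The recursion is on `b`, a bound for the last letter, which falls strictly with each
        -- exchange and cannot pass below t.
        reach-last : ∀ {N} → Supported w → ∀ b (X : Word w (suc N)) → letter X N ≤ b →
          Σ[ Y ∈ Word w (suc N) ] Path X Y × letter Y N ≡ t
        reach-last {N} supported b X z≤b with t ≟ letter X N
        ... | yes t≡z = X , ε , sym t≡z
        reach-last {N} supported zero X z≤0 | no t≢z =
          contradiction (≤-antisym (last-≥ X) (≤-trans z≤0 z≤n)) t≢z
        reach-last {N} supported (suc b) X z≤b | no t≢z
          with Y , s , y<z ← lower-last supported X (≤∧≢⇒< (last-≥ X) t≢z)
          with Z , path , e ← reach-last supported b Y (s≤s⁻¹ (≤-trans y<z z≤b))
          = Z , inj₂ s ◅ path , e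

    Fits : ℕ → (ℕ → ℕ) → ℕ → Set
    Fits N f t = (N ≡ 0 → t ≡ 0) × (∀ {j} → suc j ≡ N → t ≤ suc (f j))

    extend-valid : ∀ {N f t} → Valid N f → Fits N f t → Valid (suc N) (f [ N ≔ t ])
    extend-valid {zero}  {f} {t} v fits .start _ = ≡.trans (update-≡ f 0 t) (proj₁ fits refl)
    extend-valid {suc N} {f} {t} v fits .start _ = ≡.trans (update-≢ f t λ ()) (start v (s≤s z≤n))
    extend-valid {N} {f} {t} v fits .step {j} (s≤s 1+j≤N)
      rewrite update-≢ f {N} {j} t (<⇒≢ 1+j≤N) with suc j ≟ N
    ... | yes refl  rewrite update-≡ f (suc j) t = proj₂ fits refl
    ... | no 1+j≢N rewrite update-≢ f {N} {suc j} t 1+j≢N = step v (≤∧≢⇒< 1+j≤N 1+j≢N)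

    restrict-valid : ∀ {N f} → Valid (suc N) f → Valid N f
    restrict-valid v .start 0<N = start v (m<n⇒m<1+n 0<N)
    restrict-valid v .step j<N = step v (m<n⇒m<1+n j<N)

    module RemoveLast {N : ℕ} {w : List ℕ} {t : ℕ} (t-least : Least (λ u → 2 ≤ count u w) t)
      (supported : Supported w) (X : Word w (suc N)) (last≡t : letter X N ≡ t) where

      w′ : List ℕ
      w′ = applyDownFrom (letter X) N

      w′-content : t ∷ w′ ↭ w
      w′-content = subst (λ u → u ∷ w′ ↭ w) last≡t (content X)

      count-other : ∀ {u} → u ≢ t → count u w′ ≡ count u w
      count-other {u} u≢t = ≡.trans (sym (count-≢ w′ u≢t)) (count-↭ u w′-content)

      count-≤ : ∀ u → count u w′ ≤ count u w
      count-≤ u with u ≟ t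
      ... | yes refl = ≤-trans (n≤1+n _) (≤-reflexive (≡.trans (sym (count-≡ t w′)) (count-↭ t w′-content)))
      ... | no u≢t = ≤-reflexive (count-other u≢t)

      -- Only the count of t has dropped, so the condition could break only at i = t - 1; but no
      -- letter below t is repeated.
      supported′ : Supported w′
      supported′ i i-twice i+2∈ = subst (2 ≤_) (sym (count-other 1+i≢t))
        (supported i i-twice′ (∈-resp-↭ w′-content (there i+2∈)))
        where
        i-twice′ = ≤-trans i-twice (count-≤ i)

        1+i≢t : suc i ≢ t
        1+i≢t refl = proj₂ t-least ≤-refl i-twice′

      -- Suppose Z ends in z with z + 1 < t. As X passes z + 1 before its final t, this letter is in
      -- `w′` and hence in Z, where some z precedes it. With the final z that makes z repeated,
      -- although it is below t.
      fits : (Z : Word w′ N) → Fits N (letter Z) t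
      proj₁ (fits Z) refl = ≡.trans (sym last≡t) (start (valid X) (s≤s z≤n))
      proj₂ (fits Z) {j} refl with t ≤? suc (letter Z j)
      ... | yes t≤ = t≤
      ... | no t≰ = contradiction z-twice (proj₂ t-least (<⇒≤ 1+z<t))
        where
        z = letter Z j

        1+z<t : suc z < t
        1+z<t = ≰⇒> t≰

        1+z∈w′ : suc z ∈ w′
        1+z∈w′ with i , i<N , e ← passes-before (valid X) ≤-refl (subst (suc z <_) (sym last≡t) 1+z<t)
          = subst (_∈ w′) e (∈-applyDownFrom⁺ (letter X) i<N)

        z-twice : 2 ≤ count z w
        z-twice
          with i , i<N , e ← ∈-applyDownFrom⁻ (letter Z) (∈-resp-↭ (↭-sym (content Z)) 1+z∈w′)
          with h , h<i , fh≡z ← passes-before (valid Z) i<N (≤-reflexive e)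
          = ≤-trans (repeated⁻¹ Z (h , j , <-≤-trans h<i (s≤s⁻¹ i<N) , ≤-refl , fh≡z , refl)) (count-≤ z)

      restrict : (Y : Word w (suc N)) → letter Y N ≡ t → Word w′ N
      restrict Y y≡t = record
        { letter  = letter Y
        ; valid   = restrict-valid (valid Y)
        ; content = drop-∷ (trans
          (subst (λ u → u ∷ applyDownFrom (letter Y) N ↭ w) y≡t (content Y)) (↭-sym w′-content))
        }

      extend : Word w′ N → Word w (suc N)
      extend Z = record
        { letter  = letter Z [ N ≔ t ]
        ; valid   = extend-valid (valid Z) (fits Z)
        ; content = trans (↭-reflexive (cong₂ _∷_ (update-≡ (letter Z) N t)
                      (applyDownFrom-cong N λ j<N → update-≢ (letter Z) t (<⇒≢ j<N))))
                    (trans (prep t (content Z)) w′-content)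
        }

      extend-edge : ∀ {Y Z} → Edge Y Z → Edge (extend Y) (extend Z)
      extend-edge {Y} {Z} (inj₁ Y≗Z) = inj₁ extend-≗
        where
        extend-≗ : ∀ {j} → j < suc N → (letter Y [ N ≔ t ]) j ≡ (letter Z [ N ≔ t ]) j
        extend-≗ {j} j<1+N with j ≟ N
        ... | yes refl = ≡.trans (update-≡ (letter Y) N t) (sym (update-≡ (letter Z) N t))
        ... | no j≢N = ≡.trans (update-≢ (letter Y) t j≢N)
          (≡.trans (Y≗Z (≤∧≢⇒< (s≤s⁻¹ j<1+N) j≢N)) (sym (update-≢ (letter Z) t j≢N)))
      extend-edge {Y} {Z} (inj₂ s) = inj₂ record
        { i<j = i<j ; j<N = m<n⇒m<1+n j<N
        ; differ = λ e → differ (≡.trans (sym (old Y i<N)) (≡.trans e (old Y j<N)))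
        ; at-i = ≡.trans (old Z i<N) (≡.trans at-i (sym (old Y j<N)))
        ; at-j = ≡.trans (old Z j<N) (≡.trans at-j (sym (old Y i<N)))
        ; elsewhere = extend-elsewhere
        }
        where
        open Swapped s

        i<N : i < N
        i<N = <-trans i<j j<N

        old : ∀ (V : Word w′ N) {l} → l < N → (letter V [ N ≔ t ]) l ≡ letter V l
        old V l<N = update-≢ (letter V) t (<⇒≢ l<N)

        extend-elsewhere : ∀ {l} → l < suc N → l ≢ i → l ≢ j →
          (letter Z [ N ≔ t ]) l ≡ (letter Y [ N ≔ t ]) l
        extend-elsewhere {l} l<1+N l≢i l≢j with l ≟ N
        ... | yes refl = ≡.trans (update-≡ (letter Z) N t) (sym (update-≡ (letter Y) N t))
        ... | no l≢N = ≡.trans (old Z l<N) (≡.trans (elsewhere l<N l≢i l≢j) (sym (old Y l<N)))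
          where l<N = ≤∧≢⇒< (s≤s⁻¹ l<1+N) l≢N

      extend-restrict : ∀ Y (y≡t : letter Y N ≡ t) → Edge Y (extend (restrict Y y≡t))
      extend-restrict Y y≡t = inj₁ same
        where
        same : ∀ {j} → j < suc N → letter Y j ≡ (letter Y [ N ≔ t ]) j
        same {j} _ with j ≟ N
        ... | yes refl = ≡.trans y≡t (sym (update-≡ (letter Y) N t))
        ... | no j≢N = sym (update-≢ (letter Y) t j≢N)

    -- No letter exceeds its index. A letter z < j at index j would by induction also stand at index
    -- z, and so be repeated. Hence only the word 0, 1, ..., N - 1 is left.
    unrepeated⇒identity : ∀ {w N} (X : Word w N) → (∀ {u} → u < N → ¬ 2 ≤ count u w) →
      ∀ j → j < N → letter X j ≡ j
    unrepeated⇒identity {w} {N} X none = <-rec (λ j → j < N → letter X j ≡ j) identity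
      where
      identity : ∀ j → (∀ {i} → i < j → i < N → letter X i ≡ i) → j < N → letter X j ≡ j
      identity j ih j<N with <-cmp (letter X j) j
      ... | tri≈ _ e _   = e
      ... | tri> _ _ j<z = contradiction (letter≤index (valid X) j<N) (<⇒≱ j<z)
      ... | tri< z<j _ _ = contradiction
        (repeated⁻¹ X (letter X j , j , z<j , j<N , ih z<j (<-trans z<j j<N) , refl))
        (none (<-trans z<j j<N))

    connect : ∀ N {w} → Supported w → (X Y : Word w N) → Path X Y
    connect zero        supported X Y = inj₁ (λ ()) ◅ ε
    connect (suc N) {w} supported X Y with least (λ u → 2 ≤? count u w) (suc N)
    ... | inj₂ none = inj₁ (λ j<N → ≡.trans (unrepeated⇒identity X none _ j<N)
      (sym (unrepeated⇒identity Y none _ j<N))) ◅ ε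
    ... | inj₁ (t , t-least)
      with X′ , X⇝X′ , x≡t ← reach-last t-least supported _ X ≤-refl
      with Y′ , Y⇝Y′ , y≡t ← reach-last t-least supported _ Y ≤-refl
      = X⇝X′ ◅◅ extend-restrict X′ x≡t
      ◅ gmap extend (λ {V} {W} → extend-edge {V} {W}) (connect N supported′ (restrict X′ x≡t) (restrict Y′ y≡t))
      ◅◅ Edge-sym {X = Y′} {Y = extend (restrict Y′ y≡t)} (extend-restrict Y′ y≡t)
      ◅ Star.reverse (λ {V} {W} → Edge-sym {X = V} {Y = W}) Y⇝Y′
      -- `w′` is read off from `X′`, but `Y′` also ends in t and has the same content, so both
      -- restrict to words with content `w′`.
      where open RemoveLast t-least supported X′ x≡t

  open Words

  -- Column heights, padding and the passage to letters

  module Heights where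

    -- Read from the right, the default 0 beyond the end is the height of the padding columns.
    at : List ℕ → ℕ → ℕ
    at []       _       = 0
    at (x ∷ xs) zero    = x
    at (x ∷ xs) (suc j) = at xs j

    applyUpTo-at : ∀ l → applyUpTo (at l) (length l) ≡ l
    applyUpTo-at []       = refl
    applyUpTo-at (x ∷ xs) = cong (x ∷_) (applyUpTo-at xs)

    reverse-at : ∀ l → reverse l ≡ applyDownFrom (at l) (length l)
    reverse-at l = ≡.trans (cong reverse (sym (applyUpTo-at l))) (reverse-applyUpTo (at l) (length l))

    at-applyUpTo : ∀ f N {j} → j < N → at (applyUpTo f N) j ≡ f j
    at-applyUpTo f (suc N) {zero}  _ = refl
    at-applyUpTo f (suc N) {suc j} (s≤s j<N) = at-applyUpTo (f ∘ suc) N j<N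

    applyUpTo-cong : ∀ {f g : ℕ → ℕ} N → (∀ {j} → j < N → f j ≡ g j) → applyUpTo f N ≡ applyUpTo g N
    applyUpTo-cong zero    f≗g = refl
    applyUpTo-cong (suc N) f≗g = cong₂ _∷_ (f≗g z<s) (applyUpTo-cong N (f≗g ∘ s<s))

    padded : ℕ → List ℕ → List ℕ
    padded p l = replicate p 0 ++ l

    length-padded : ∀ p l → length (padded p l) ≡ p + length l
    length-padded p l = ≡.trans (length-++ (replicate p 0)) (cong (_+ length l) (length-replicate p))

    at-padded-< : ∀ {p j} l → j < p → at (padded p l) j ≡ 0
    at-padded-< {suc p} {zero}  l _ = refl
    at-padded-< {suc p} {suc j} l (s≤s j<p) = at-padded-< l j<p

    at-padded-+ : ∀ p j l → at (padded p l) (p + j) ≡ at l j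
    at-padded-+ zero    j l = refl
    at-padded-+ (suc p) j l = at-padded-+ p j l

    letters : List ℕ → ℕ → ℕ
    letters l j = j ∸ at l j

    word : List ℕ → List ℕ
    word l = applyDownFrom (letters l) (length l)

    Monotone : List ℕ → Set
    Monotone l = ∀ {j} → suc j < length l → at l j ≤ at l (suc j)

    -- All roots are non-negative, so that the truncated subtraction in `letters` is exact.
    BelowDiagonal : List ℕ → Set
    BelowDiagonal l = ∀ {j} → j < length l → at l j ≤ j

    padded-monotone : ∀ p {l} → Monotone l → Monotone (padded p l)
    padded-monotone zero    m = m
    padded-monotone (suc p) m {zero}  _         = z≤n
    padded-monotone (suc p) m {suc j} (s≤s j<) = padded-monotone p m j<

    split-index : ∀ p {n j} → j < p + n → j < p ⊎ ∃[ i ] i < n × j ≡ p + i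
    split-index p {n} {j} j<p+n with j <? p
    ... | yes j<p = inj₁ j<p
    ... | no j≮p = inj₂ (j ∸ p , +-cancelˡ-< p _ _ (subst (_< p + n) (sym p+[j∸p]≡j) j<p+n) , sym p+[j∸p]≡j)
      where p+[j∸p]≡j = m+[n∸m]≡n (≮⇒≥ j≮p)

    padded-below : ∀ p {l} → BelowDiagonal l → BelowDiagonal (padded p l)
    padded-below p {l} b {j} j<
      with split-index p (subst (j <_) (length-padded p l) j<)
    ... | inj₁ j<p rewrite at-padded-< l j<p = z≤n
    ... | inj₂ (i , i<n , refl) rewrite at-padded-+ p i l = ≤-trans (b i<n) (m≤n+m i p)

    letters-padded-< : ∀ {p j} l → j < p → letters (padded p l) j ≡ j
    letters-padded-< {j = j} l j<p = cong (j ∸_) (at-padded-< l j<p)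

    letters-padded-+ : ∀ p {l j} → BelowDiagonal l → j < length l →
      letters (padded p l) (p + j) ≡ p + letters l j
    letters-padded-+ p {l} {j} b j<n =
      ≡.trans (cong (p + j ∸_) (at-padded-+ p j l)) (+-∸-assoc p (b j<n))

    -- As heights weakly increase, the root gains at most 1 per column. The diagonal bound is what
    -- turns `suc j ∸ at l j` into `suc (j ∸ at l j)`.
    letters-valid : ∀ {l} → Monotone l → BelowDiagonal l → Valid (length l) (letters l)
    letters-valid {l} m b .start _ = 0∸n≡0 (at l 0)
    letters-valid {l} m b .step {j} j< = ≤-trans (∸-monoʳ-≤ (suc j) (m j<))
      (≤-reflexive (+-∸-assoc 1 (b (<⇒≤ j<))))

    roots-applyDownFrom : ∀ h N →
      roots (applyDownFrom h N) ≡ applyDownFrom (λ j → + j -ᶻ + h j) N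
    roots-applyDownFrom h zero    = refl
    roots-applyDownFrom h (suc N) = cong₂ _∷_
      (cong (λ n → + n -ᶻ + h N) (length-applyDownFrom h N)) (roots-applyDownFrom h N)

    +-∸ : ∀ {m n} → n ≤ m → + m -ᶻ + n ≡ + (m ∸ n)
    +-∸ {m} {n} n≤m = ≡.trans (ℤ.m-n≡m⊖n m n) (ℤ.⊖-≥ n≤m)

    roots-word : ∀ {l} → BelowDiagonal l → roots (reverse l) ≡ map +_ (word l)
    roots-word {l} b = begin
      roots (reverse l)                                     ≡⟨ cong roots (reverse-at l) ⟩
      roots (applyDownFrom (at l) (length l))               ≡⟨ roots-applyDownFrom (at l) (length l) ⟩
      applyDownFrom (λ j → + j -ᶻ + at l j) (length l)      ≡⟨ applyDownFrom-cong (length l) (+-∸ ∘ b) ⟩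
      applyDownFrom (+_ ∘ letters l) (length l)             ≡⟨ map-applyDownFrom (letters l) +_ (length l) ⟨
      map +_ (word l)                                       ∎
      where open ≡-Reasoning

    below-from-roots : ∀ {l} → All (0ℤ ≤ᶻ_) (roots (reverse l)) → BelowDiagonal l
    below-from-roots {l} nonneg {j} j<
      rewrite reverse-at l | roots-applyDownFrom (at l) (length l)
      = ℤ.drop‿+≤+ (ℤ.0≤i-j⇒j≤i (All.lookup nonneg (∈-applyDownFrom⁺ (λ j → + j -ᶻ + at l j) j<)))

    rookSequence-∷ : ∀ b bs → rookSequence (roots (b ∷ bs)) ≗ append (+ b) (rookSequence (roots bs))
    rookSequence-∷ b bs k rewrite length-roots bs =
      cong (λ t → append t (rookSequence (roots bs)) k) (lemma (+ length bs) (+ b))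
      where
      lemma : ∀ n b → n -ᶻ (n -ᶻ b) ≡ b
      lemma = ℤ.solve-∀

    -- `append 0ℤ` changes most sequences but fixes `empty`. That is enough, because padding columns
    -- stand leftmost, at the bottom of the recursion.
    rookSequence-zeros : ∀ {zs} → All (_≡ 0) zs → rookSequence (roots zs) ≗ empty
    rookSequence-zeros [] k = refl
    rookSequence-zeros {_ ∷ zs} (refl ∷ zs≡0) k = ≡.trans (rookSequence-∷ 0 zs k)
      (≡.trans (append-cong 0ℤ (rookSequence-zeros zs≡0) k) (append-0-empty k))
      where
      append-0-empty : append 0ℤ empty ≗ empty
      append-0-empty zero          = refl
      append-0-empty (suc zero)    = refl
      append-0-empty (suc (suc k)) = ≡.trans (ℤ.+-identityˡ _) (ℤ.*-zeroʳ (0ℤ -ᶻ + suc k))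

    rookSequence-++-zeros : ∀ bs {zs} → All (_≡ 0) zs →
      rookSequence (roots (bs ++ zs)) ≗ rookSequence (roots bs)
    rookSequence-++-zeros []       zs≡0 k = rookSequence-zeros zs≡0 k
    rookSequence-++-zeros (b ∷ bs) {zs} zs≡0 k = ≡.trans (rookSequence-∷ b (bs ++ zs) k)
      (≡.trans (append-cong (+ b) (rookSequence-++-zeros bs zs≡0) k) (sym (rookSequence-∷ b bs k)))

    reverse-zeros : ∀ p → All (_≡ 0) (reverse (replicate p 0))
    reverse-zeros p = All-resp-↭ (↭-sym (↭-reverse (replicate p 0))) (All.replicate⁺ p refl)

    rookSequence-padded : ∀ p l →
      rookSequence (roots (reverse (padded p l))) ≗ rookSequence (roots (reverse l))
    rookSequence-padded p l k rewrite reverse-++ (replicate p 0) l =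
      rookSequence-++-zeros (reverse l) (reverse-zeros p) k

    -- Equal sequences make the root lists permutations of each other. Non-negativity travels along
    -- the permutation and yields the diagonal bound for `l′`; then both lists consist of naturals
    -- and the permutation descends to the letters.
    word-transfer : ∀ l l′ → length l ≡ length l′ → BelowDiagonal l →
      rookSequence (roots (reverse l)) ≗ rookSequence (roots (reverse l′)) →
      BelowDiagonal l′ × word l′ ↭ word l
    word-transfer l l′ len b e = b′ , unmap (subst₂ _↭_ (roots-word {l′} b′) (roots-word {l} b) (↭-sym rs))
      where
      length-rr : ∀ l → length (roots (reverse l)) ≡ length l
      length-rr l = ≡.trans (length-roots (reverse l)) (length-reverse l)

      rs : roots (reverse l) ↭ roots (reverse l′)
      rs = rookSequence-injective _ _
        (≡.trans (length-rr l) (≡.trans len (sym (length-rr l′)))) e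

      b′ : BelowDiagonal l′
      b′ = below-from-roots {l′} (All-resp-↭ rs (subst (All (0ℤ ≤ᶻ_)) (sym (roots-word {l} b))
        (All.map⁺ (All.universal (λ _ → +≤+ z≤n) (word l)))))

      unmap : ∀ {xs ys : List ℕ} → map +_ xs ↭ map +_ ys → xs ↭ ys
      unmap {xs} {ys} p = subst₂ _↭_ (abs-map xs) (abs-map ys) (map⁺ ℤ.∣_∣ p)
        where
        abs-map : ∀ zs → map ℤ.∣_∣ (map +_ zs) ≡ zs
        abs-map zs = ≡.trans (sym (map-∘ zs)) (map-id zs)

  open Heights

  -- Boards from words, and edges of the graph from swaps

  module Boards where

    columnHeights : ∀ {n} → FerrersBoard n → List ℕ
    columnHeights B = Vec.toList (heights B)

    length-columnHeights : ∀ {n} (B : FerrersBoard n) → length (columnHeights B) ≡ n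
    length-columnHeights B = length-toList (heights B)

    columnHeights-monotone : ∀ {n} (B : FerrersBoard n) → Monotone (columnHeights B)
    columnHeights-monotone B = monotone (increasing B)
      where
      monotone : ∀ {n} {v : Vec ℕ n} → Linked _≤_ v → Monotone (Vec.toList v)
      monotone {v = x Vec.∷ y Vec.∷ v} (x≤y ∷ _) {zero}  _         = x≤y
      monotone {v = x Vec.∷ y Vec.∷ v} (_ ∷ ys)  {suc j} (s≤s j<) = monotone ys j<
      monotone {v = x Vec.∷ Vec.[]}    _         {zero}  (s≤s ())

    at-columnHeights : ∀ {n} (B : FerrersBoard n) i → at (columnHeights B) (toℕ i) ≡ height B i
    at-columnHeights B = go (heights B)
      where
      go : ∀ {n} (v : Vec ℕ n) i → at (Vec.toList v) (toℕ i) ≡ Vec.lookup v i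
      go (x Vec.∷ v) Fin.zero    = refl
      go (x Vec.∷ v) (Fin.suc i) = go v i

    -- Rook numbers ignore padding, so rook equivalence becomes equality of content once `p` and `q`
    -- have brought both boards to one width.
    vertex-word : ∀ {m n} {B : FerrersBoard m} {C : FerrersBoard n} p q →
      p + m ≡ q + n → RookEquivalent B C → BelowDiagonal (columnHeights B) →
      BelowDiagonal (padded q (columnHeights C)) ×
      word (padded q (columnHeights C)) ↭ word (padded p (columnHeights B))
    vertex-word {m} {n} {B} {C} p q e r b = word-transfer (padded p lB) (padded q lC)
      (≡.trans (len p B) (≡.trans e (sym (len q C)))) (padded-below p {lB} b) λ k → begin
        rookSequence (roots (reverse (padded p lB))) k ≡⟨ rookSequence-padded p lB k ⟩
        rookSequence (roots (reverse lB)) k            ≡⟨ rookNumber≡rookSequence B k ⟨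
        + rookNumber k B                               ≡⟨ cong +_ (r k) ⟩
        + rookNumber k C                               ≡⟨ rookNumber≡rookSequence C k ⟩
        rookSequence (roots (reverse lC)) k            ≡⟨ rookSequence-padded q lC k ⟨
        rookSequence (roots (reverse (padded q lC))) k ∎
      where
      open ≡-Reasoning
      lB = columnHeights B
      lC = columnHeights C
      len : ∀ {n} p (D : FerrersBoard n) → length (padded p (columnHeights D)) ≡ p + n
      len p D = ≡.trans (length-padded p (columnHeights D)) (cong (_+_ p) (length-columnHeights D))

    toList-tabulate : ∀ N (h : ℕ → ℕ) → Vec.toList (Vec.tabulate {n = N} (h ∘ toℕ)) ≡ applyUpTo h N
    toList-tabulate zero    h = refl
    toList-tabulate (suc N) h = cong (h 0 ∷_) (toList-tabulate N (h ∘ suc))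

    linked-tabulate : ∀ N (h : ℕ → ℕ) → (∀ {j} → suc j < N → h j ≤ h (suc j)) →
      Linked _≤_ (Vec.tabulate {n = N} (h ∘ toℕ))
    linked-tabulate zero          h m = []
    linked-tabulate (suc zero)    h m = [-]
    linked-tabulate (suc (suc N)) h m = m (s<s z<s) ∷ linked-tabulate (suc N) (h ∘ suc) (m ∘ s<s)

    wordHeight : ∀ {w N} → Word w N → ℕ → ℕ
    wordHeight X j = j ∸ letter X j

    wordBoard : ∀ {w N} → Word w N → FerrersBoard N
    wordBoard {N = N} X = record
      { heights    = Vec.tabulate (wordHeight X ∘ toℕ)
      ; increasing = linked-tabulate N (wordHeight X) λ {j} j< → ∸-monoʳ-≤ (suc j) (step (valid X) j<)
      }

    columnHeights-wordBoard : ∀ {w N} (X : Word w N) →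
      columnHeights (wordBoard X) ≡ applyUpTo (wordHeight X) N
    columnHeights-wordBoard {N = N} X = toList-tabulate N (wordHeight X)

    height-wordBoard : ∀ {w N} (X : Word w N) i → height (wordBoard X) i ≡ wordHeight X (toℕ i)
    height-wordBoard X = lookup∘tabulate (wordHeight X ∘ toℕ)

    -- The right-hand side depends on the content alone, so every word over `w` gives a vertex of
    -- the same graph.
    rookNumber-wordBoard : ∀ {w N} (X : Word w N) k →
      + rookNumber k (wordBoard X) ≡ rookSequence (map +_ w) k
    rookNumber-wordBoard {w} {N} X k = begin
      + rookNumber k (wordBoard X)
        ≡⟨ rookNumber≡rookSequence (wordBoard X) k ⟩
      rookSequence (roots (reverse (columnHeights (wordBoard X)))) k
        ≡⟨ cong (λ l → rookSequence (roots l) k) (≡.trans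
             (cong reverse (columnHeights-wordBoard X)) (reverse-applyUpTo (wordHeight X) N)) ⟩
      rookSequence (roots (applyDownFrom (wordHeight X) N)) k
        ≡⟨ cong (λ zs → rookSequence zs k) (≡.trans (roots-applyDownFrom (wordHeight X) N)
             (applyDownFrom-cong N exact)) ⟩
      rookSequence (applyDownFrom (+_ ∘ letter X) N) k
        ≡⟨ cong (λ zs → rookSequence zs k) (map-applyDownFrom (letter X) +_ N) ⟨
      rookSequence (map +_ (applyDownFrom (letter X) N)) k
        ≡⟨ rookSequence-↭ (map⁺ +_ (content X)) k ⟩
      rookSequence (map +_ w) k ∎
      where
      open ≡-Reasoning
      exact : ∀ {j} → j < N → + j -ᶻ + wordHeight X j ≡ + letter X j
      exact {j} j<N = ≡.trans (+-∸ (m∸n≤m j (letter X j)))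
        (cong +_ (m∸[m∸n]≡n (letter≤index (valid X) j<N)))

    module _ {n} (B : FerrersBoard n) {w : List ℕ}
      (B-w : ∀ k → + rookNumber k B ≡ rookSequence (map +_ w) k) where

      wordVertex : ∀ {N} → Word w N → Vertex B
      wordVertex {N} X = record
        { columns    = N
        ; board      = wordBoard X
        ; equivalent = λ k → ℤ.+-injective (≡.trans (B-w k) (sym (rookNumber-wordBoard X k)))
        }

      private
        telescope : ∀ {a b m} → a ≤ b → b ≤ m → m ∸ a ≡ m ∸ b + (b ∸ a)
        telescope {a} {b} {m} a≤b b≤m =
          ≡.trans (cong (_∸ a) (sym (m∸n+n≡m b≤m))) (+-∸-assoc (m ∸ b) a≤b)

      -- The column whose letter grows by the swap loses that many cells.
      swapped⇒differ : ∀ {N} (X Y : Word w N) a b → a < N → b < N → a ≢ b →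
        letter X a < letter X b → letter Y a ≡ letter X b → letter Y b ≡ letter X a →
        (∀ {l} → l < N → l ≢ a → l ≢ b → letter Y l ≡ letter X l) →
        DifferInTwoColumns (wordBoard X) (wordBoard Y)
      swapped⇒differ {N} X Y a b a<N b<N a≢b Xa<Xb Ya Yb same =
        i , j , (λ i≡j → a≢b (≡.trans (sym i≡a) (≡.trans (cong toℕ i≡j) j≡b))) , elsewhere ,
        letter X b ∸ letter X a , m<n⇒0<n∸m Xa<Xb , at-i , sym at-j
        where
        open ≡-Reasoning
        i = fromℕ< a<N
        j = fromℕ< b<N
        i≡a = Fin.toℕ-fromℕ< a<N
        j≡b = Fin.toℕ-fromℕ< b<N
        k = letter X b ∸ letter X a

        elsewhere : ∀ l → l ≢ i → l ≢ j → height (wordBoard X) l ≡ height (wordBoard Y) l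
        elsewhere l l≢i l≢j = begin
          height (wordBoard X) l    ≡⟨ height-wordBoard X l ⟩
          toℕ l ∸ letter X (toℕ l)  ≡⟨ cong (toℕ l ∸_) (same (Fin.toℕ<n l)
            (λ e → l≢i (Fin.toℕ-injective (≡.trans e (sym i≡a))))
            (λ e → l≢j (Fin.toℕ-injective (≡.trans e (sym j≡b))))) ⟨
          toℕ l ∸ letter Y (toℕ l)  ≡⟨ height-wordBoard Y l ⟨
          height (wordBoard Y) l    ∎

        at-i : height (wordBoard X) i ≡ height (wordBoard Y) i + k
        at-i = begin
          height (wordBoard X) i     ≡⟨ height-wordBoard X i ⟩
          wordHeight X (toℕ i)       ≡⟨ cong (wordHeight X) i≡a ⟩
          a ∸ letter X a             ≡⟨ telescope (<⇒≤ Xa<Xb) (subst (_≤ a) Ya (letter≤index (valid Y) a<N)) ⟩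
          a ∸ letter X b + k         ≡⟨ cong (λ z → a ∸ z + k) Ya ⟨
          wordHeight Y a + k         ≡⟨ cong (λ c → wordHeight Y c + k) i≡a ⟨
          wordHeight Y (toℕ i) + k   ≡⟨ cong (_+ k) (height-wordBoard Y i) ⟨
          height (wordBoard Y) i + k ∎

        at-j : height (wordBoard Y) j ≡ height (wordBoard X) j + k
        at-j = begin
          height (wordBoard Y) j     ≡⟨ height-wordBoard Y j ⟩
          wordHeight Y (toℕ j)       ≡⟨ cong (wordHeight Y) j≡b ⟩
          b ∸ letter Y b             ≡⟨ cong (b ∸_) Yb ⟩
          b ∸ letter X a             ≡⟨ telescope (<⇒≤ Xa<Xb) (letter≤index (valid X) b<N) ⟩
          wordHeight X b + k         ≡⟨ cong (λ c → wordHeight X c + k) j≡b ⟨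
          wordHeight X (toℕ j) + k   ≡⟨ cong (_+ k) (height-wordBoard X j) ⟨
          height (wordBoard X) j + k ∎

      edge⇒adjacent : ∀ {N} (X Y : Word w N) → Edge X Y →
        SameVertex (wordVertex X) (wordVertex Y) ⊎ Adjacent (wordVertex X) (wordVertex Y)
      edge⇒adjacent {N} X Y (inj₁ X≗Y) = inj₁ (0 , 0 ,
        ≡.trans (columnHeights-wordBoard X) (≡.trans
          (applyUpTo-cong N λ {j} j<N → cong (j ∸_) (X≗Y j<N)) (sym (columnHeights-wordBoard Y))))
      edge⇒adjacent {N} X Y (inj₂ s) =
        inj₂ (N , wordBoard X , wordBoard Y , (0 , 0 , refl) , (0 , 0 , refl) , differs)
        where
        open Swapped s
        i<N = <-trans i<j j<N

        differs : DifferInTwoColumns (wordBoard X) (wordBoard Y)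
        differs with <-cmp (letter X i) (letter X j)
        ... | tri< lt _ _ = swapped⇒differ X Y i j i<N j<N (<⇒≢ i<j) lt at-i at-j elsewhere
        ... | tri≈ _ e _  = contradiction e differ
        ... | tri> _ _ gt = swapped⇒differ X Y j i j<N i<N (<⇒≢ i<j ∘ sym) gt at-j at-i
          λ l<N l≢j l≢i → elsewhere l<N l≢i l≢j

  open Boards

  -- Multiplicities of roots as repetitions of letters, before and after padding

  module Multiplicities where

    vec-count-accept : ∀ {A : Set} {P : A → Set} (P? : Decidable P) {n} x (xs : Vec A n) →
      P x → Vec.count P? (x Vec.∷ xs) ≡ suc (Vec.count P? xs)
    vec-count-accept P? x xs Px with P? x
    ... | yes _  = refl
    ... | no ¬Px = contradiction Px ¬Px

    vec-count-reject : ∀ {A : Set} {P : A → Set} (P? : Decidable P) {n} x (xs : Vec A n) →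
      ¬ P x → Vec.count P? (x Vec.∷ xs) ≡ Vec.count P? xs
    vec-count-reject P? x xs ¬Px with P? x
    ... | yes Px = contradiction Px ¬Px
    ... | no _   = refl

    vec-count : ∀ u n (f : ℕ → ℕ) (r : Fin n → ℤ) → (∀ i → r i ≡ + f (toℕ i)) →
      Vec.count ((+ u) ℤ.≟_) (Vec.tabulate r) ≡ count u (applyUpTo f n)
    vec-count u zero    f r e = refl
    vec-count u (suc n) f r e with u ≟ f 0
    ... | yes refl = ≡.trans
      (vec-count-accept ((+ u) ℤ.≟_) (r Fin.zero) (Vec.tabulate (r ∘ Fin.suc)) (sym (e Fin.zero)))
      (≡.trans (cong suc (vec-count u n (f ∘ suc) (r ∘ Fin.suc) (e ∘ Fin.suc)))
        (sym (count-≡ u (applyUpTo (f ∘ suc) n))))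
    ... | no u≢f0 = ≡.trans
      (vec-count-reject ((+ u) ℤ.≟_) (r Fin.zero) (Vec.tabulate (r ∘ Fin.suc))
        (λ u≡r → u≢f0 (ℤ.+-injective (≡.trans u≡r (e Fin.zero)))))
      (≡.trans (vec-count u n (f ∘ suc) (r ∘ Fin.suc) (e ∘ Fin.suc))
        (sym (count-≢ (applyUpTo (f ∘ suc) n) u≢f0)))

    below-diagonal : ∀ {n} (B : FerrersBoard n) → VecAll.All (0ℤ ≤ᶻ_) (rootVector B) →
      BelowDiagonal (columnHeights B)
    below-diagonal {n} B nonneg {j} j< = subst₂ _≤_
      (≡.trans (sym (at-columnHeights B i)) (cong (at (columnHeights B)) i≡j)) i≡j
      (ℤ.drop‿+≤+ (ℤ.0≤i-j⇒j≤i (VecAll.tabulate⁻ nonneg i)))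
      where
      j<n = subst (j <_) (length-columnHeights B) j<
      i = Fin.fromℕ< j<n
      i≡j = Fin.toℕ-fromℕ< j<n

    module _ {n} (B : FerrersBoard n) (below : BelowDiagonal (columnHeights B)) where

      private
        l = columnHeights B
        n≡ = length-columnHeights B

      multiplicity≡count : ∀ u → multiplicity B (+ u) ≡ count u (applyDownFrom (letters l) n)
      multiplicity≡count u = ≡.trans
        (vec-count u n (letters l) _ root)
        (count-↭ u (↭-trans (↭-sym (↭-reverse (applyUpTo (letters l) n)))
          (↭-reflexive (reverse-applyUpTo (letters l) n))))
        where
        root : ∀ i → + toℕ i -ᶻ + height B i ≡ + letters l (toℕ i)
        root i rewrite sym (at-columnHeights B i) =
          +-∸ (below (subst (toℕ i <_) (sym n≡) (Fin.toℕ<n i)))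
  
      multiplicity⇒repeated : ∀ u → multiplicity B (+ u) > 1 → Repeated (letters l) n u
      multiplicity⇒repeated u = count≥2⇒repeated (letters l) n u ∘ subst (2 ≤_) (multiplicity≡count u)

      repeated⇒multiplicity : ∀ u → Repeated (letters l) n u → multiplicity B (+ u) > 1
      repeated⇒multiplicity u = subst (2 ≤_) (sym (multiplicity≡count u)) ∘ repeated⇒count≥2 (letters l) n u

      occurs⇒multiplicity : ∀ {c} → c < n → multiplicity B (+ letters l c) ≢ 0
      occurs⇒multiplicity c<n e = contradiction
        (subst (1 ≤_) (≡.trans (sym (multiplicity≡count _)) e) (count≥1 (letters l) n c<n)) λ ()

      multiplicity⇒occurs : ∀ u → multiplicity B (+ u) ≢ 0 → ∃[ c ] c < n × letters l c ≡ u
      multiplicity⇒occurs u m≢0 = occurs (letters l) n u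
        (subst (1 ≤_) (multiplicity≡count u) (n≢0⇒n>0 m≢0))

      module _ (p : ℕ) where

        private
          pad-letter : ∀ {j} → j < n → letters (padded p l) (p + j) ≡ p + letters l j
          pad-letter {j} j<n = letters-padded-+ p {l} below (subst (j <_) (sym n≡) j<n)

          pad-letter-≥ : ∀ {j v} → j < n → letters (padded p l) (p + j) ≡ v → v ≡ p + letters l j
          pad-letter-≥ j<n e = ≡.trans (sym e) (pad-letter j<n)

        repeated-padded⁺ : ∀ {u} → Repeated (letters l) n u → Repeated (letters (padded p l)) (p + n) (p + u)
        repeated-padded⁺ (i , j , i<j , j<n , ei , ej) =
          p + i , p + j , +-monoʳ-< p i<j , +-monoʳ-< p j<n ,
          ≡.trans (pad-letter (<-trans i<j j<n)) (cong (_+_ p) ei) ,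
          ≡.trans (pad-letter j<n) (cong (_+_ p) ej)

        -- The letters 0, ..., p - 1 of the padding differ from each other and from all shifted
        -- letters, which are at least p. So both occurrences lie in original columns.
        repeated-padded⁻ : ∀ {v} → Repeated (letters (padded p l)) (p + n) v →
          ∃[ u ] v ≡ p + u × Repeated (letters l) n u
        repeated-padded⁻ {v} (i , j , i<j , j< , ei , ej)
          with split-index p (<-trans i<j j<) | split-index p j<
        ... | inj₁ i<p | inj₁ j<p = contradiction
          (≡.trans (≡.trans (sym (letters-padded-< l i<p)) ei) (≡.trans (sym ej) (letters-padded-< l j<p)))
          (<⇒≢ i<j)
        ... | inj₁ i<p | inj₂ (j′ , j′<n , refl) = contradiction
          (≤-trans (m≤m+n p _) (≤-reflexive (≡.trans (sym (pad-letter-≥ j′<n ej))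
            (≡.trans (sym ei) (letters-padded-< l i<p)))))
          (<⇒≱ i<p)
        ... | inj₂ (i′ , i′<n , refl) | inj₁ j<p = contradiction (<-≤-trans j<p (m≤m+n p i′)) (<⇒≯ i<j)
        ... | inj₂ (i′ , i′<n , refl) | inj₂ (j′ , j′<n , refl) =
          letters l i′ , pad-letter-≥ i′<n ei ,
          i′ , j′ , +-cancelˡ-< p _ _ i<j , j′<n , refl ,
          +-cancelˡ-≡ p _ _ (≡.trans (sym (pad-letter-≥ j′<n ej)) (pad-letter-≥ i′<n ei))

        occurs-padded⁻ : ∀ {j u} → j < p + n → letters (padded p l) j ≡ p + u →
          ∃[ c ] c < n × letters l c ≡ u
        occurs-padded⁻ {j} {u} j< e with split-index p j<
        ... | inj₁ j<p = contradiction
          (≤-trans (m≤m+n p u) (≤-reflexive (≡.trans (sym e) (letters-padded-< l j<p)))) (<⇒≱ j<p)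
        ... | inj₂ (c , c<n , refl) = c , c<n , sym (+-cancelˡ-≡ p _ _ (pad-letter-≥ c<n e))

  open Multiplicities

  -- The condition implies connectedness

  module Sufficiency {n} (B : FerrersBoard n) (below : BelowDiagonal (columnHeights B)) where

    private l = columnHeights B

    module _ (M : ℤ) (M-greatest : ∀ k → multiplicity B k ≢ 0 → k ≤ᶻ M)
      (condition : ∀ i → 0ℤ ≤ᶻ i → i <ᶻ M -ᶻ 1ℤ → multiplicity B i > 1 → multiplicity B (i +ᶻ 1ℤ) > 1) where

      module _ (p : ℕ) where

        private
          L : ℕ → ℕ
          L = letters (padded p l)

          len : length (padded p l) ≡ p + n
          len = ≡.trans (length-padded p l) (cong (_+_ p) (length-columnHeights B))

          shift-letter : ∀ u → suc (suc (p + u)) ≡ p + suc (suc u)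
          shift-letter u = sym (≡.trans (+-suc p (suc u)) (cong suc (+-suc p u)))

          u<M-1 : ∀ {u} → + (2 + u) ≤ᶻ M → + u <ᶻ M -ᶻ 1ℤ
          u<M-1 {u} h = ℤ.<-≤-trans (ℤ.+<+ (n<1+n u)) (ℤ.+-monoˡ-≤ -[1+ 0 ] h)

        -- A repeated letter is p + u with u a repeated root, and an occurrence of p + u + 2 comes
        -- from a root u + 2. The latter is at most M, which says u < M - 1, so the condition
        -- applies at u.
        padded-supported : Supported (word (padded p l))
        padded-supported v v-twice v+2∈
          with u , refl , u-repeated ← repeated-padded⁻ B below p
            (subst (λ N → Repeated L N v) len (count≥2⇒repeated L (length (padded p l)) v v-twice))
          with j , j< , e ← ∈-applyDownFrom⁻ L v+2∈
          with c , c<n , zc ← occurs-padded⁻ B below p {u = 2 + u}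
            (subst (j <_) len j<) (≡.trans (sym e) (shift-letter u))
          = repeated⇒count≥2 L (length (padded p l)) (suc (p + u))
              (subst₂ (Repeated L) (sym len) (+-suc p u)
                (repeated-padded⁺ B below p (multiplicity⇒repeated B below (suc u) 1+u-twice)))
          where
          1+u-twice : multiplicity B (+ suc u) > 1
          1+u-twice = subst (λ t → multiplicity B (+ t) > 1) (+-comm u 1)
            (condition (+ u) (+≤+ z≤n)
              (u<M-1 (subst (λ t → + t ≤ᶻ M) zc (M-greatest _ (occurs⇒multiplicity B below c<n))))
              (repeated⇒multiplicity B below u u-repeated))

      connected : Connected B
      connected X Y = inj₁ (vertexWord-same X pX eX) ◅
        gmap (wordVertex B B-w) (λ {V} {W} → edge⇒adjacent B B-w V W)
          (connect N (padded-supported pB) (vertexWord X pX eX) (vertexWord Y pY eY))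
        ◅◅ inj₁ (SameVertex-sym Y (wordVertex B B-w (vertexWord Y pY eY)) (vertexWord-same Y pY eY)) ◅ ε
        where
        open ≡-Reasoning
        -- The common width is the sum of the three numbers of columns; each board is padded by the
        -- columns of the other two.
        pB = columns X + columns Y
        N  = pB + n
        w  = word (padded pB l)
        pX = columns Y + n
        pY = columns X + n

        eX : N ≡ pX + columns X
        eX = lemma (columns X) (columns Y) n
          where
          lemma : ∀ x y n → x + y + n ≡ y + n + x
          lemma = solve-∀

        eY : N ≡ pY + columns Y
        eY = lemma (columns X) (columns Y) n
          where
          lemma : ∀ x y n → x + y + n ≡ x + n + y
          lemma = solve-∀

        B-w : ∀ k → + rookNumber k B ≡ rookSequence (map +_ w) k
        B-w k = begin
          + rookNumber k B                               ≡⟨ rookNumber≡rookSequence B k ⟩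
          rookSequence (roots (reverse l)) k             ≡⟨ rookSequence-padded pB l k ⟨
          rookSequence (roots (reverse (padded pB l))) k
            ≡⟨ cong (λ zs → rookSequence zs k) (roots-word {padded pB l} (padded-below pB {l} below)) ⟩
          rookSequence (map +_ w) k                      ∎

        module _ (V : Vertex B) (q : ℕ) (e : N ≡ q + columns V) where

          private
            lV = padded q (columnHeights (board V))
            both = vertex-word {B = B} {C = board V} pB q e (equivalent V) below

            len : length lV ≡ N
            len = ≡.trans (length-padded q (columnHeights (board V)))
              (≡.trans (cong (_+_ q) (length-columnHeights (board V))) (sym e))

          vertexWord : Word w N
          vertexWord = record
            { letter  = letters lV
            ; valid   = subst (λ N → Valid N (letters lV)) len
                (letters-valid {lV} (padded-monotone q (columnHeights-monotone (board V))) (proj₁ both))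
            ; content = subst (λ N → applyDownFrom (letters lV) N ↭ w) len (proj₂ both)
            }

          vertexWord-same : SameVertex V (wordVertex B B-w vertexWord)
          vertexWord-same = q , 0 , sym (begin
            columnHeights (wordBoard vertexWord)              ≡⟨ columnHeights-wordBoard vertexWord ⟩
            applyUpTo (wordHeight vertexWord) N               ≡⟨ cong (applyUpTo (wordHeight vertexWord)) len ⟨
            applyUpTo (wordHeight vertexWord) (length lV)
              ≡⟨ applyUpTo-cong (length lV) (λ j< → m∸[m∸n]≡n (proj₁ both j<)) ⟩
            applyUpTo (at lV) (length lV)                     ≡⟨ applyUpTo-at lV ⟩
            lV                                                ∎)

        SameVertex-sym : ∀ V W → SameVertex {B = B} V W → SameVertex {B = B} W V
        SameVertex-sym V W (p , q , e) = q , p , sym e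

  -- Columns are numbered from the right here, so that padding does not affect
  -- their index d. On a board with N columns, d + r d = N - 1 - z, where r d is
  -- the height and z the root of column d.
  level : (ℕ → ℕ) → ℕ → ℕ
  level r d = d + r d

  -- An edge as seen from the right. Heights and levels differ by the index only, so the preserved
  -- sum is also a sum of levels; in that form it rules out an exchange of neighbours.
  record Exchange (r s : ℕ → ℕ) : Set where
    field
      {d e}     : ℕ
      elsewhere : ∀ {c} → c ≢ d → c ≢ e → r c ≡ s c
      sum       : r d + r e ≡ s d + s e

  Exchange-sym : ∀ {r s} → Exchange r s → Exchange s r
  Exchange-sym x = record
    { elsewhere = λ c≢d c≢e → sym (elsewhere c≢d c≢e)
    ; sum       = sym sum
    } where open Exchange x

  -- An edge cannot move the only column at level K

  module Crossing (K : ℕ) where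

    -- High levels mean small letters. For K = n - 2 - i the fields say that heights decrease
    -- leftwards, that i + 1 occurs at most once and that some letter is at least i + 2.
    record Regular (r : ℕ → ℕ) : Set where
      field
        antitone : ∀ d → r (suc d) ≤ r d
        unique   : ∀ {d e} → level r d ≡ K → level r e ≡ K → d ≡ e
        low      : ∃[ d ] level r d < K

    Above : (ℕ → ℕ) → ℕ → Set
    Above r d = ∀ {e} → d ≤ e → K < level r e

    record Crosses (r : ℕ → ℕ) (p : ℕ) : Set where
      field
        on     : level r p ≡ K
        before : ∃[ q ] p ≡ suc q × level r q < K
        after  : ∀ {d} → p < d → K < level r d

    module _ {r : ℕ → ℕ} (antitone : ∀ d → r (suc d) ≤ r d) where

      -- By `antitone` the level grows by at most 1 per index, so it cannot jump over K.
      rises : ∀ {q} t → q ≤ t → level r q ≤ K → K ≤ level r t → ∃[ p ] q ≤ p × p ≤ t × level r p ≡ K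
      rises {q} t q≤t lo hi with q ≟ t
      ... | yes refl = q , ≤-refl , ≤-refl , ≤-antisym lo hi
      rises zero    z≤n lo hi | no 0≢0 = contradiction refl 0≢0
      rises (suc t) q≤t lo hi | no q≢t with K ≤? level r t
      ... | yes K≤ with p , q≤p , p≤t , e ← rises t (s≤s⁻¹ (≤∧≢⇒< q≤t q≢t)) lo K≤
        = p , q≤p , m≤n⇒m≤1+n p≤t , e
      ... | no K≰ = suc t , q≤t , ≤-refl ,
        ≤-antisym (≤-trans (s≤s (+-monoʳ-≤ t (antitone t))) (≰⇒> K≰)) hi

    -- From the low index q the level must reach K, at the latest at q + K, where the index alone
    -- contributes that much. A level of at most K further left, or of at least K at the right
    -- neighbour, would force a second meeting with K.
    crosses : ∀ {r} → Regular r → ∃[ p ] Crosses r p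
    crosses {r} R
      with q , q-low ← Regular.low R
      with p , q≤p , _ , on ← rises (Regular.antitone R) (q + K) (m≤m+n q K) (<⇒≤ q-low)
        (≤-trans (m≤n+m K q) (m≤m+n (q + K) _))
      = p , record { on = on ; before = before p on q≤p ; after = after }
      where
      open Regular R

      after : ∀ {d} → p < d → K < level r d
      after {d} p<d with level r d ≤? K
      ... | no ≰K = ≰⇒> ≰K
      ... | yes ≤K with p′ , d≤p′ , _ , on′ ← rises antitone (d + K) (m≤m+n d K) ≤K
              (≤-trans (m≤n+m K d) (m≤m+n (d + K) _))
        = contradiction (unique on on′) (<⇒≢ (<-≤-trans p<d d≤p′))

      before : ∀ p → level r p ≡ K → q ≤ p → ∃[ p′ ] p ≡ suc p′ × level r p′ < K
      before p on q≤p with q ≟ p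
      ... | yes refl = contradiction on (<⇒≢ q-low)
      before zero    on z≤n | no 0≢0 = contradiction refl 0≢0
      before (suc p) on q≤p | no q≢p with K ≤? level r p
      ... | no K≰ = p , refl , ≰⇒> K≰
      ... | yes K≤ with p′ , _ , p′≤p , on′ ← rises antitone p (s≤s⁻¹ (≤∧≢⇒< q≤p q≢p)) (<⇒≤ q-low) K≤
        = contradiction (unique on′ on) (<⇒≢ (s≤s p′≤p))

    -- Both p and q change their level, so nothing else does. The index q - 1 is below K in s. If it
    -- is not p, it is unchanged, yet lies beyond p and is above K in r. If it is p, the equal sums
    -- identify the level of s at p, below K, with the level of r at q, above K.
    crossing-≮ : ∀ {r s p q} → Regular s → Crosses r p → Crosses s q → Exchange r s → ¬ p < q
    crossing-≮ {r} {s} {p} {q} S cr cs x p<q = absurd (Crosses.before cs)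
      where
      open Exchange x
      open Crosses

      p≢q : p ≢ q
      p≢q = <⇒≢ p<q

      p-differs : r p ≢ s p
      p-differs e = p≢q (Regular.unique S (≡.trans (sym (cong (_+_ p) e)) (on cr)) (on cs))

      q-differs : r q ≢ s q
      q-differs e = <⇒≢ (after cr p<q) (sym (≡.trans (cong (_+_ q) e) (on cs)))

      where-differs : ∀ {c} → r c ≢ s c → c ≡ d ⊎ c ≡ e
      where-differs {c} rc≢sc with c ≟ d | c ≟ e
      ... | yes c≡d | _       = inj₁ c≡d
      ... | no _    | yes c≡e = inj₂ c≡e
      ... | no c≢d  | no c≢e  = contradiction (elsewhere c≢d c≢e) rc≢sc

      normalised : (∀ {c} → c ≢ p → c ≢ q → r c ≡ s c) × r p + r q ≡ s p + s q
      normalised with where-differs p-differs | where-differs q-differs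
      ... | inj₁ refl | inj₁ refl = contradiction refl p≢q
      ... | inj₂ refl | inj₂ refl = contradiction refl p≢q
      ... | inj₁ refl | inj₂ refl = elsewhere , sum
      ... | inj₂ refl | inj₁ refl = (λ c≢e c≢d → elsewhere c≢d c≢e)
        , ≡.trans (+-comm (r p) (r q)) (≡.trans sum (+-comm (s q) (s p)))

      absurd : ¬ (∃[ q′ ] q ≡ suc q′ × level s q′ < K)
      absurd (q′ , refl , q′-low) with q′ ≟ p
      ... | no q′≢p = <-asym q′-low (subst (K <_) (cong (_+_ q′) (proj₁ normalised q′≢p (<⇒≢ ≤-refl)))
        (after cr (≤∧≢⇒< (s≤s⁻¹ p<q) (q′≢p ∘ sym))))
      ... | yes refl = <⇒≢ (<-trans q′-low (after cr p<q)) (+-cancelˡ-≡ K _ _ (begin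
        K + level s p             ≡⟨ cong (_+ level s p) (on cs) ⟨
        level s q + level s p     ≡⟨ lemma q p (s q) (s p) ⟩
        q + p + (s p + s q)       ≡⟨ cong (_+_ (q + p)) (proj₂ normalised) ⟨
        q + p + (r p + r q)       ≡⟨ lemma′ q p (r q) (r p) ⟩
        level r p + level r q     ≡⟨ cong (_+ level r q) (on cr) ⟩
        K + level r q             ∎))
        where
        open ≡-Reasoning
        lemma : ∀ q p sq sp → (q + sq) + (p + sp) ≡ q + p + (sp + sq)
        lemma = solve-∀
        lemma′ : ∀ q p rq rp → q + p + (rp + rq) ≡ (p + rp) + (q + rq)
        lemma′ = solve-∀

    -- `Above` at d says that d lies beyond the crossing, and an edge leaves the crossing where it
    -- is.
    above-invariant : ∀ {r s d} → Regular r → Regular s → Exchange r s → Above r d → Above s d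
    above-invariant {r} {s} {d} R S x above
      with p , cr ← crosses R
      with q , cs ← crosses S
      with <-cmp p q
    ... | tri< p<q _ _ = contradiction p<q (crossing-≮ S cr cs x)
    ... | tri> _ _ q<p = contradiction q<p (crossing-≮ R cs cr (Exchange-sym x))
    ... | tri≈ _ refl _ = λ d≤e → Crosses.after cs (<-≤-trans p<d d≤e)
      where
      p<d : p < d
      p<d = ≰⇒> λ d≤p → <⇒≢ (above d≤p) (sym (Crosses.on cr))

  fromRight : ∀ {n} → FerrersBoard n → ℕ → ℕ
  fromRight B = at (reverse (columnHeights B))

  -- Boards read from the right, independently of padding

  module FromRight where

    at-applyDownFrom-< : ∀ f N {d} → d < N → at (applyDownFrom f N) d ≡ f (N ∸ suc d)
    at-applyDownFrom-< f (suc N) {zero}  _         = refl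
    at-applyDownFrom-< f (suc N) {suc d} (s≤s d<N) = at-applyDownFrom-< f N d<N

    at-applyDownFrom-≥ : ∀ f N {d} → N ≤ d → at (applyDownFrom f N) d ≡ 0
    at-applyDownFrom-≥ f zero    _         = refl
    at-applyDownFrom-≥ f (suc N) (s≤s N≤d) = at-applyDownFrom-≥ f N N≤d

    at-reverse-< : ∀ l {d} → d < length l → at (reverse l) d ≡ at l (length l ∸ suc d)
    at-reverse-< l d< rewrite reverse-at l = at-applyDownFrom-< (at l) (length l) d<

    at-reverse-≥ : ∀ l {d} → length l ≤ d → at (reverse l) d ≡ 0
    at-reverse-≥ l ≤d rewrite reverse-at l = at-applyDownFrom-≥ (at l) (length l) ≤d

    at-++-zeros : ∀ xs {zs} → All (_≡ 0) zs → at (xs ++ zs) ≗ at xs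
    at-++-zeros []       []           d       = refl
    at-++-zeros []       (refl ∷ _)   zero    = refl
    at-++-zeros []       (_ ∷ zs≡0)   (suc d) = at-++-zeros [] zs≡0 d
    at-++-zeros (x ∷ xs) zs≡0         zero    = refl
    at-++-zeros (x ∷ xs) zs≡0         (suc d) = at-++-zeros xs zs≡0 d

    at-reverse-padded : ∀ p l → at (reverse (padded p l)) ≗ at (reverse l)
    at-reverse-padded p l d rewrite reverse-++ (replicate p 0) l =
      at-++-zeros (reverse l) (reverse-zeros p) d

    ≐⇒fromRight-≗ : ∀ {m n} (B : FerrersBoard m) (C : FerrersBoard n) → B ≐ C → fromRight B ≗ fromRight C
    ≐⇒fromRight-≗ B C (p , q , e) d = begin
      at (reverse (columnHeights B)) d            ≡⟨ at-reverse-padded p (columnHeights B) d ⟨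
      at (reverse (padded p (columnHeights B))) d ≡⟨ cong (λ l → at (reverse l) d) e ⟩
      at (reverse (padded q (columnHeights C))) d ≡⟨ at-reverse-padded q (columnHeights C) d ⟩
      at (reverse (columnHeights C)) d            ∎
      where open ≡-Reasoning

    flip-index : ∀ {N d} → d < N → N ≡ suc (d + (N ∸ suc d))
    flip-index d<N = sym (m+[n∸m]≡n d<N)

    flip-< : ∀ {N} d → d < N → N ∸ suc d < N
    flip-< {suc N} d _ = s≤s (m∸n≤m N d)

    flip-flip : ∀ {N d} → d < N → N ∸ suc (N ∸ suc d) ≡ d
    flip-flip {suc N} (s≤s d≤N) = m∸[m∸n]≡n d≤N

    at-reverse-antitone : ∀ l → Monotone l → ∀ d → at (reverse l) (suc d) ≤ at (reverse l) d
    at-reverse-antitone l m d with suc d <? length l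
    ... | no ≮ = ≤-trans (≤-reflexive (at-reverse-≥ l (≮⇒≥ ≮))) z≤n
    ... | yes 1+d< = begin
      at (reverse l) (suc d)                  ≡⟨ at-reverse-< l 1+d< ⟩
      at l (length l ∸ suc (suc d))           ≤⟨ m (subst (_< length l) next (flip-< d (<⇒≤ 1+d<))) ⟩
      at l (suc (length l ∸ suc (suc d)))     ≡⟨ cong (at l) next ⟨
      at l (length l ∸ suc d)                 ≡⟨ at-reverse-< l (<⇒≤ 1+d<) ⟨
      at (reverse l) d                        ∎
      where
      open ≤-Reasoning
      next : length l ∸ suc d ≡ suc (length l ∸ suc (suc d))
      next = ∸-suc′ 1+d<
        where
        ∸-suc′ : ∀ {m n} → m < n → n ∸ m ≡ suc (n ∸ suc m)
        ∸-suc′ {zero}  {suc n} _         = refl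
        ∸-suc′ {suc m} {suc n} (s≤s m<n) = ∸-suc′ m<n

    fromRight-height : ∀ {n} (B : FerrersBoard n) i → fromRight B (n ∸ suc (toℕ i)) ≡ height B i
    fromRight-height {n} B i = begin
      at (reverse l) (n ∸ suc (toℕ i))
        ≡⟨ at-reverse-< l (subst (n ∸ suc (toℕ i) <_) (sym len) (flip-< (toℕ i) i<n)) ⟩
      at l (length l ∸ suc (n ∸ suc (toℕ i)))
        ≡⟨ cong (λ N → at l (N ∸ suc (n ∸ suc (toℕ i)))) len ⟩
      at l (n ∸ suc (n ∸ suc (toℕ i)))
        ≡⟨ cong (at l) (flip-flip i<n) ⟩
      at l (toℕ i)
        ≡⟨ at-columnHeights B i ⟩
      height B i ∎
      where
      open ≡-Reasoning
      l   = columnHeights B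
      len = length-columnHeights B
      i<n = Fin.toℕ<n i

    -- A column of letter z sits at level N - 1 - z.
    level-letter : ∀ l {d} → BelowDiagonal l → d < length l →
      level (at (reverse l)) d + suc (letters l (length l ∸ suc d)) ≡ length l
    level-letter l {d} b d< = begin
      d + at (reverse l) d + suc (letters l j)  ≡⟨ cong (λ h → d + h + suc (letters l j)) (at-reverse-< l d<) ⟩
      d + at l j + suc (letters l j)            ≡⟨ lemma d (at l j) (letters l j) ⟩
      suc (d + (at l j + letters l j))          ≡⟨ cong (λ t → suc (d + t)) (m+[n∸m]≡n (b (flip-< d d<))) ⟩
      suc (d + j)                               ≡⟨ flip-index d< ⟨
      length l                                  ∎
      where
      open ≡-Reasoning
      j = length l ∸ suc d
      lemma : ∀ d h z → d + h + suc z ≡ suc (d + (h + z))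
      lemma = solve-∀

    differ⇒exchange : ∀ {N} (C D : FerrersBoard N) → DifferInTwoColumns C D →
      Exchange (fromRight C) (fromRight D)
    differ⇒exchange {N} C D (i , j , i≢j , same , k , _ , at-i , at-j) = record
      { d = N ∸ suc (toℕ i)
      ; e = N ∸ suc (toℕ j)
      ; elsewhere = elsewhere
      ; sum = begin
          fromRight C (N ∸ suc (toℕ i)) + fromRight C (N ∸ suc (toℕ j))
            ≡⟨ cong₂ _+_ (fromRight-height C i) (fromRight-height C j) ⟩
          height C i + height C j         ≡⟨ cong (_+ height C j) at-i ⟩
          height D i + k + height C j     ≡⟨ lemma (height D i) k (height C j) ⟩
          height D i + (height C j + k)   ≡⟨ cong (_+_ (height D i)) at-j ⟩
          height D i + height D j
            ≡⟨ cong₂ _+_ (fromRight-height D i) (fromRight-height D j) ⟨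
          fromRight D (N ∸ suc (toℕ i)) + fromRight D (N ∸ suc (toℕ j)) ∎
      }
      where
      open ≡-Reasoning
      lemma : ∀ a k b → a + k + b ≡ a + (b + k)
      lemma = solve-∀

      beyond : ∀ (B : FerrersBoard N) {c} → N ≤ c → fromRight B c ≡ 0
      beyond B {c} N≤c = at-reverse-≥ (columnHeights B) (subst (_≤ c) (sym (length-columnHeights B)) N≤c)

      elsewhere : ∀ {c} → c ≢ N ∸ suc (toℕ i) → c ≢ N ∸ suc (toℕ j) → fromRight C c ≡ fromRight D c
      elsewhere {c} c≢i c≢j with c <? N
      ... | no c≮N = ≡.trans (beyond C (≮⇒≥ c≮N)) (sym (beyond D (≮⇒≥ c≮N)))
      ... | yes c<N = begin
        fromRight C c                       ≡⟨ cong (fromRight C) index ⟨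
        fromRight C (N ∸ suc (toℕ l))       ≡⟨ fromRight-height C l ⟩
        height C l                          ≡⟨ same l
          (λ l≡i → c≢i (≡.trans (sym index) (cong (λ l → N ∸ suc (toℕ l)) l≡i)))
          (λ l≡j → c≢j (≡.trans (sym index) (cong (λ l → N ∸ suc (toℕ l)) l≡j))) ⟩
        height D l                          ≡⟨ fromRight-height D l ⟨
        fromRight D (N ∸ suc (toℕ l))       ≡⟨ cong (fromRight D) index ⟩
        fromRight D c                       ∎
        where
        l : Fin N
        l = Fin.fromℕ< (flip-< c c<N)

        index : N ∸ suc (toℕ l) ≡ c
        index = ≡.trans (cong (λ t → N ∸ suc t) (Fin.toℕ-fromℕ< (flip-< c c<N))) (flip-flip c<N)

  open FromRight

  -- Explicit words from a sorted list of letters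

  module Arrangements where

    -- `b` is the largest letter allowed next: 0 at the start, later one more than the preceding
    -- letter.
    ValidFrom : ℕ → List ℕ → Set
    ValidFrom b []       = ⊤
    ValidFrom b (x ∷ xs) = x ≤ b × ValidFrom (suc x) xs

    validFrom⇒valid : ∀ l → ValidFrom 0 l → Valid (length l) (at l)
    validFrom⇒valid []      _          = record { start = λ () ; step = λ () }
    validFrom⇒valid (x ∷ l) (x≤0 , v) = record { start = λ _ → n≤0⇒n≡0 x≤0 ; step = steps x l v }
      where
      steps : ∀ x l → ValidFrom (suc x) l → ∀ {j} → suc j < suc (length l) → at (x ∷ l) (suc j) ≤ suc (at (x ∷ l) j)
      steps x (y ∷ l) (y≤ , v) {zero}  _         = y≤
      steps x (y ∷ l) (y≤ , v) {suc j} (s≤s j<) = steps y l v j<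
      steps x []      _        {zero}  (s≤s ())

    -- A first letter above b would have its predecessor in the list too, by closure, but in sorted
    -- order nothing smaller can follow.
    sorted⇒validFrom : ∀ b l → All (λ x → b ≤ suc x) l → AllPairs _≤_ l →
      (∀ {k} → b ≤ k → suc k ∈ l → k ∈ l) → ValidFrom b l
    sorted⇒validFrom b []      _             _          _      = tt
    sorted⇒validFrom b (x ∷ l) (b≤1+x ∷ _) (x≤l ∷ l↗) closed =
      head x refl , sorted⇒validFrom (suc x) l (All.map s≤s x≤l) l↗ tail
      where
      head : ∀ y → y ≡ x → y ≤ b
      head zero    _    = z≤n
      head (suc k) refl with suc k ≤? b
      ... | yes ≤b = ≤b
      ... | no ≰b with closed (s≤s⁻¹ (≰⇒> ≰b)) (here refl)
      ...   | here k≡1+k = contradiction (sym k≡1+k) 1+n≢n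
      ...   | there k∈l  = contradiction (All.lookup x≤l k∈l) 1+n≰n

      tail : ∀ {k} → suc x ≤ k → suc k ∈ l → k ∈ l
      tail x<k 1+k∈l with closed (≤-trans b≤1+x x<k) (there 1+k∈l)
      ... | here refl = contradiction x<k (<-irrefl refl)
      ... | there k∈l = k∈l

    split-at : ∀ i l → AllPairs _≤_ l →
      ∃[ lo ] ∃[ hi ] l ≡ lo ++ hi × All (_≤ i) lo × All (i <_) hi
    split-at i []      _           = [] , [] , refl , [] , []
    split-at i (x ∷ l) (x≤l ∷ l↗) with x ≤? i
    ... | no x≰i = [] , x ∷ l , refl , [] , ≰⇒> x≰i ∷ All.map (<-≤-trans (≰⇒> x≰i)) x≤l
    ... | yes x≤i with lo , hi , refl , ≤i , i< ← split-at i l l↗ = x ∷ lo , hi , refl , x≤i ∷ ≤i , i<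

    -- What precedes h is at most i, and h exceeds i, so h is i + 1 and may also follow the inserted
    -- i.
    insert-valid : ∀ {b i h hi} lo → b ≤ suc i → All (_≤ i) lo → i < h →
      ValidFrom b (lo ++ h ∷ hi) → ValidFrom b (lo ++ i ∷ h ∷ hi)
    insert-valid []       b≤1+i _            i<h (h≤b , v) =
      <⇒≤ (<-≤-trans i<h h≤b) , ≤-trans h≤b b≤1+i , v
    insert-valid (x ∷ lo) b≤1+i (x≤i ∷ lo≤i) i<h (x≤b , v) =
      x≤b , insert-valid lo (s≤s x≤i) lo≤i i<h v

    -- All letters from h on exceed i, so the final i is a descent, and descents are unrestricted.
    append-valid : ∀ {b i h hi} lo → i < h → All (i <_) hi →
      ValidFrom b (lo ++ h ∷ hi) → ValidFrom b (lo ++ h ∷ hi ++ i ∷ [])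
    append-valid (x ∷ lo) i<h i<hi (x≤b , v) = x≤b , append-valid lo i<h i<hi v
    append-valid {hi = []}     [] i<h _              (h≤b , _) = h≤b , <⇒≤ (m<n⇒m<1+n i<h) , tt
    append-valid {hi = y ∷ hi} [] i<h (i<y ∷ i<hi) (h≤b , v) = h≤b , append-valid [] i<y i<hi v

    count⇒∈ : ∀ k l → 1 ≤ count k l → k ∈ l
    count⇒∈ k (x ∷ l) c with k ≟ x
    ... | yes refl = here refl
    ... | no k≢x = there (count⇒∈ k l (subst (1 ≤_) (count-≢ l k≢x) c))

    at-lo : ∀ i lo {rest} → All (_≤ i) lo → ∀ {j} → j ≤ length lo → at (lo ++ i ∷ rest) j ≤ i
    at-lo i []       _            {zero}  _         = ≤-refl
    at-lo i (x ∷ lo) (x≤i ∷ lo≤i) {zero}  _         = x≤i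
    at-lo i (x ∷ lo) (x≤i ∷ lo≤i) {suc j} (s≤s j≤) = at-lo i lo lo≤i j≤

    at-length : ∀ lo {h rest} → at (lo ++ h ∷ rest) (length lo) ≡ h
    at-length []       = refl
    at-length (x ∷ lo) = at-length lo

  open Arrangements

  -- Failure of the condition disconnects the graph

  module Necessity {n} (B : FerrersBoard n) (below : BelowDiagonal (columnHeights B))
    (K i : ℕ) (K+2+i≡n : K + suc (suc i) ≡ n)
    (single : ¬ Repeated (letters (columnHeights B)) n (suc i))
    (top : ∃[ c ] c < n × suc (suc i) ≤ letters (columnHeights B) c) where

    open Crossing K

    private
      l = columnHeights B
      z = letters l
      length-l = length-columnHeights B

      K<n : K < n
      K<n = subst (suc K ≤_) K+2+i≡n (≤-trans (s≤s (m≤m+n K (suc i))) (≤-reflexive (sym (+-suc K (suc i)))))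

    module _ (V : Vertex B) where

      private
        c   = columns V
        -- V gains n columns and B gains c, so both have n + c. The letter i + 1 becomes c + i + 1,
        -- whose level n + c - 1 - (c + i + 1) is K for every V.
        lV  = padded n (columnHeights (board V))
        r   = fromRight (board V)
        N   = length lV
        both = vertex-word {B = B} {C = board V} c n (+-comm c n) (equivalent V) below
        bV  = proj₁ both

        N≡ : N ≡ n + c
        N≡ = ≡.trans (length-padded n (columnHeights (board V)))
          (cong (_+_ n) (length-columnHeights (board V)))

        r≗ : at (reverse lV) ≗ r
        r≗ = at-reverse-padded n (columnHeights (board V))

        level-r : ∀ {d} → d < N → level r d + suc (letters lV (N ∸ suc d)) ≡ N
        level-r {d} d<N = subst (λ h → d + h + suc (letters lV (N ∸ suc d)) ≡ N) (r≗ d)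
          (level-letter lV bV d<N)

        -- The index of a column at level K is at most K < n, so it is a column of the padded board
        -- and not one of the zeros beyond its end.
        level-K⇒< : ∀ {d} → level r d ≡ K → d < N
        level-K⇒< {d} e = ≤-<-trans (subst (d ≤_) e (m≤m+n d (r d)))
          (<-≤-trans K<n (≤-trans (m≤m+n n c) (≤-reflexive (sym N≡))))

        level-K⇒letter : ∀ {d} → level r d ≡ K → letters lV (N ∸ suc d) ≡ c + suc i
        level-K⇒letter {d} e = suc-injective (+-cancelˡ-≡ K _ _ (begin
          K + suc (letters lV (N ∸ suc d))          ≡⟨ cong (_+ suc (letters lV (N ∸ suc d))) e ⟨
          level r d + suc (letters lV (N ∸ suc d))  ≡⟨ level-r (level-K⇒< e) ⟩
          N                                         ≡⟨ N≡ ⟩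
          n + c                                     ≡⟨ cong (_+ c) K+2+i≡n ⟨
          K + suc (suc i) + c                       ≡⟨ lemma K i c ⟩
          K + suc (c + suc i)                       ∎))
          where
          open ≡-Reasoning
          lemma : ∀ K i c → K + suc (suc i) + c ≡ K + suc (c + suc i)
          lemma = solve-∀

        length-pad : length (padded c l) ≡ c + n
        length-pad = ≡.trans (length-padded c l) (cong (_+_ c) length-l)

        not-repeated : ¬ Repeated (letters lV) N (c + suc i)
        not-repeated rep
          with u , e , rep′ ← repeated-padded⁻ B below c
            (subst (λ L → Repeated (letters (padded c l)) L (c + suc i)) length-pad
              (count≥2⇒repeated (letters (padded c l)) (length (padded c l)) (c + suc i)
                (subst (2 ≤_) (count-↭ (c + suc i) (proj₂ both))
                  (repeated⇒count≥2 (letters lV) N (c + suc i) rep))))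
          = single (subst (Repeated z n) (sym (+-cancelˡ-≡ c _ _ e)) rep′)

        -- A root of at least i + 2 reappears in the padded V shifted by c, and such a letter has a
        -- level below K.
        low-column : ∃[ a ] a < n × suc (suc i) ≤ z a → ∃[ d ] level r d < K
        low-column (a , a<n , ≤za)
          with j , j<N , e ← ∈-applyDownFrom⁻ (letters lV) (∈-resp-↭ (↭-sym (proj₂ both))
            (∈-applyDownFrom⁺ (letters (padded c l)) {c + a} (subst (c + a <_) (sym length-pad) (+-monoʳ-< c a<n))))
          = N ∸ suc j , +-cancelʳ-≤ (suc (suc i) + c) _ _ (begin
            suc (level r d) + (suc (suc i) + c)        ≡⟨ lemma (level r d) i c ⟩
            level r d + suc (c + suc (suc i))          ≤⟨ +-monoʳ-≤ (level r d) (s≤s (+-monoʳ-≤ c ≤za)) ⟩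
            level r d + suc (c + z a)
              ≡⟨ cong (λ t → level r d + suc t) (letters-padded-+ c {l} below (subst (a <_) (sym length-l) a<n)) ⟨
            level r d + suc (letters (padded c l) (c + a)) ≡⟨ cong (λ t → level r d + suc t) e ⟩
            level r d + suc (letters lV j)
              ≡⟨ cong (λ j → level r d + suc (letters lV j)) (flip-flip j<N) ⟨
            level r d + suc (letters lV (N ∸ suc d))   ≡⟨ level-r (flip-< j j<N) ⟩
            N                                          ≡⟨ N≡ ⟩
            n + c                                      ≡⟨ cong (_+ c) K+2+i≡n ⟨
            K + suc (suc i) + c                        ≡⟨ +-assoc K (suc (suc i)) c ⟩
            K + (suc (suc i) + c)                      ∎)
          where
          d = N ∸ suc j
          open ≤-Reasoning
          lemma : ∀ L i c → suc L + (suc (suc i) + c) ≡ L + suc (c + suc (suc i))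
          lemma = solve-∀

      regular : Regular r
      regular .Regular.low = low-column top
      regular .Regular.antitone = at-reverse-antitone (columnHeights (board V)) (columnHeights-monotone (board V))
      regular .Regular.unique {d} {e} d-on e-on with <-cmp (N ∸ suc d) (N ∸ suc e)
      ... | tri< lt _ _ = contradiction
        (_ , _ , lt , flip-< e (level-K⇒< e-on) , level-K⇒letter d-on , level-K⇒letter e-on) not-repeated
      ... | tri> _ _ gt = contradiction
        (_ , _ , gt , flip-< d (level-K⇒< d-on) , level-K⇒letter e-on , level-K⇒letter d-on) not-repeated
      ... | tri≈ _ eq _ = ≡.trans (sym (flip-flip (level-K⇒< d-on)))
        (≡.trans (cong (λ j → N ∸ suc j) eq) (flip-flip (level-K⇒< e-on)))
    above-step : ∀ {X Y : Vertex B} {d} → SameVertex X Y ⊎ Adjacent X Y →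
      Above (fromRight (board X)) d → Above (fromRight (board Y)) d
    above-step {X} {Y} (inj₁ same) above {e} d≤e =
      subst (λ h → K < e + h) (≐⇒fromRight-≗ (board X) (board Y) same e) (above d≤e)
    above-step {X} {Y} (inj₂ (N , C , D , C≐X , D≐Y , differ)) =
      above-invariant (regular X) (regular Y) record
        { elsewhere = λ {c} c≢d c≢e → ≡.trans (sym (rX c)) (≡.trans (elsewhere c≢d c≢e) (rY c))
        ; sum = subst₂ _≡_ (cong₂ _+_ (rX d) (rX e)) (cong₂ _+_ (rY d) (rY e)) sum
        }
      where
      open Exchange (differ⇒exchange C D differ)
      rX = ≐⇒fromRight-≗ C (board X) C≐X
      rY = ≐⇒fromRight-≗ D (board Y) D≐Y

    above-star : ∀ {X Y : Vertex B} {d} → Star (λ V W → SameVertex V W ⊎ Adjacent V W) X Y →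
      Above (fromRight (board X)) d → Above (fromRight (board Y)) d
    above-star ε above = above
    above-star {X} {Y} (_◅_ {j = Z} s path) above = above-star {Z} {Y} path (above-step {X} {Z} s above)

    private
      w : List ℕ
      w = applyDownFrom z n

      B-w : ∀ k → + rookNumber k B ≡ rookSequence (map +_ w) k
      B-w k = ≡.trans (rookNumber≡rookSequence B k) (≡.trans
        (cong (λ zs → rookSequence zs k) (roots-word {l} below))
        (cong (λ N → rookSequence (map +_ (applyDownFrom z N)) k) length-l))

      z-valid : Valid n z
      z-valid = subst (λ N → Valid N z) length-l (letters-valid {l} (columnHeights-monotone B) below)

    listWord : ∀ xs → xs ↭ w → ValidFrom 0 xs → Word w n
    listWord xs xs↭w v = record
      { letter  = at xs
      ; valid   = subst (λ N → Valid N (at xs)) len (validFrom⇒valid xs v)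
      ; content = ↭-trans (↭-reflexive (≡.trans (cong (applyDownFrom (at xs)) (sym len)) (sym (reverse-at xs))))
          (↭-trans (↭-reverse xs) xs↭w)
      }
      where
      len : length xs ≡ n
      len = ≡.trans (↭-length xs↭w) (length-applyDownFrom z n)

    level-word : ∀ (X : Word w n) {d} → d < n →
      level (fromRight (wordBoard X)) d + suc (letter X (n ∸ suc d)) ≡ n
    level-word X {d} d<n = subst₂ (λ N t → level (fromRight (wordBoard X)) d + suc t ≡ N) len letter-eq
      (level-letter lX lX-below (subst (d <_) (sym len) d<n))
      where
      lX  = columnHeights (wordBoard X)
      len = length-columnHeights (wordBoard X)

      at-lX : ∀ {j} → j < n → at lX j ≡ j ∸ letter X j
      at-lX {j} j<n rewrite columnHeights-wordBoard X = at-applyUpTo (wordHeight X) n j<n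

      lX-below : BelowDiagonal lX
      lX-below {j} j< = subst (_≤ j) (sym (at-lX (subst (j <_) len j<))) (m∸n≤m j (letter X j))

      letter-eq : letters lX (length lX ∸ suc d) ≡ letter X (n ∸ suc d)
      letter-eq rewrite len = ≡.trans (cong (_∸_ (n ∸ suc d)) (at-lX (flip-< d d<n)))
        (m∸[m∸n]≡n (letter≤index (valid X) (flip-< d d<n)))

    -- Two words with the same letters which differ in the position of the first
    -- letter above i: in the second an i has been moved to the end.
    disconnected : Repeated z n i → ¬ Connected B
    disconnected i-repeated@(a , _ , a<b , b<n , za≡i , _) connected
      with zs , w↭ ← ∈⇒↭∷ (subst (_∈ w) za≡i (∈-applyDownFrom⁺ z (<-trans a<b b<n)))
      with lo , hi , s≡ , lo≤i , i<hi ← split-at i (sort zs) (Linked⇒AllPairs ≤-trans (sort-↗ zs))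
      = absurd zs w↭ lo hi s≡ lo≤i i<hi
      where
      absurd : ∀ zs → w ↭ i ∷ zs → ∀ lo hi → sort zs ≡ lo ++ hi →
        All (_≤ i) lo → All (i <_) hi → ⊥
      absurd zs w↭ lo hi s≡ lo≤i i<hi = go hi s≡ i<hi
        where
        i∈zs : i ∈ zs
        i∈zs = count⇒∈ i zs (s≤s⁻¹ (subst (2 ≤_)
          (≡.trans (count-↭ i w↭) (count-≡ i zs)) (repeated⇒count≥2 z n i i-repeated)))

        ∈w⇒∈sort : ∀ {k} → k ∈ w → k ∈ sort zs
        ∈w⇒∈sort k∈w = ∈-resp-↭ (↭-sym (sort-↭ zs)) (∈zs (∈-resp-↭ w↭ k∈w))
          where
          ∈zs : ∀ {k} → k ∈ i ∷ zs → k ∈ zs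
          ∈zs (here refl)  = i∈zs
          ∈zs (there k∈zs) = k∈zs

        -- One i was taken out of `w`, but i is repeated, so every letter of `w` still occurs in
        -- `zs`, including all predecessors.
        closed : ∀ {k} → 0 ≤ k → suc k ∈ sort zs → k ∈ sort zs
        closed _ 1+k∈s
          with j , j<n , e ← ∈-applyDownFrom⁻ z (∈-resp-↭ (↭-sym w↭) (there (∈-resp-↭ (sort-↭ zs) 1+k∈s)))
          with j′ , j′<j , zj′≡k ← passes-before z-valid j<n (≤-reflexive e)
          = ∈w⇒∈sort (subst (_∈ w) zj′≡k (∈-applyDownFrom⁺ z (<-trans j′<j j<n)))

        s-valid : ValidFrom 0 (sort zs)
        s-valid = sorted⇒validFrom 0 (sort zs) (All.universal (λ _ → z≤n) _)
          (Linked⇒AllPairs ≤-trans (sort-↗ zs)) closed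

        go : ∀ hi → sort zs ≡ lo ++ hi → All (i <_) hi → ⊥
        -- The letter of at least i + 2 provided by `top` exceeds i, so it must lie in `hi`.
        go [] s≡ _ = let c , c<n , i+2≤ = top in
          contradiction (All.lookup lo≤i (subst (z c ∈_) (≡.trans s≡ (++-identityʳ lo))
            (∈w⇒∈sort (∈-applyDownFrom⁺ z c<n)))) (<⇒≱ (<-trans (n<1+n i) i+2≤))
        go (h ∷ hi) s≡ (i<h ∷ i<hi) =
          contradiction (above-star (connected V₁ V₂) above ≤-refl) (≤⇒≯ not-above)
          where
          i∷s↭w : i ∷ lo ++ h ∷ hi ↭ w
          i∷s↭w = ↭-trans (prep i (↭-trans (↭-reflexive (sym s≡)) (sort-↭ zs))) (↭-sym w↭)

          w₁ = lo ++ i ∷ h ∷ hi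
          w₂ = lo ++ h ∷ hi ++ i ∷ []

          w₁↭ : w₁ ↭ w
          w₁↭ = ↭-trans (shift i lo (h ∷ hi)) i∷s↭w

          w₂↭ : w₂ ↭ w
          w₂↭ = ↭-trans (↭-reflexive (sym (++-assoc lo (h ∷ hi) (i ∷ []))))
            (↭-trans (↭-sym (∷↭∷ʳ i (lo ++ h ∷ hi))) i∷s↭w)

          lo++hi-valid : ValidFrom 0 (lo ++ h ∷ hi)
          lo++hi-valid = subst (ValidFrom 0) s≡ s-valid

          X₁ X₂ : Word w n
          X₁ = listWord w₁ w₁↭ (insert-valid lo z≤n lo≤i i<h lo++hi-valid)
          X₂ = listWord w₂ w₂↭ (append-valid lo i<h i<hi lo++hi-valid)

          V₁ V₂ : Vertex B
          V₁ = wordVertex B B-w X₁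
          V₂ = wordVertex B B-w X₂

          lo<n : length lo < n
          lo<n = <-≤-trans (<-≤-trans (m<m+n (length lo) z<s) (≤-reflexive (sym (length-++ lo))))
            (≤-reflexive (≡.trans (↭-length w₁↭) (length-applyDownFrom z n)))

          -- The index from the right of the place just after `lo`, which holds i in `w₁` and h in
          -- `w₂`.
          d = n ∸ suc (length lo)

          above : Above (fromRight (wordBoard X₁)) d
          above {e} d≤e with e <? n
          ... | no e≮n = <-≤-trans K<n (≤-trans (≮⇒≥ e≮n) (m≤m+n e _))
          ... | yes e<n = +-cancelʳ-≤ (suc i) _ _ (begin
            suc K + suc i                     ≡⟨ +-suc K (suc i) ⟨
            K + suc (suc i)                   ≡⟨ K+2+i≡n ⟩
            n                                 ≡⟨ level-word X₁ e<n ⟨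
            level r₁ e + suc (at w₁ (n ∸ suc e))
              ≤⟨ +-monoʳ-≤ (level r₁ e) (s≤s (at-lo i lo lo≤i
                (≤-trans (∸-monoʳ-≤ n (s≤s d≤e)) (≤-reflexive (flip-flip lo<n))))) ⟩
            level r₁ e + suc i                ∎)
            where
            open ≤-Reasoning
            r₁ = fromRight (wordBoard X₁)

          not-above : level (fromRight (wordBoard X₂)) d ≤ K
          not-above = +-cancelʳ-≤ (suc (suc i)) _ _ (begin
            level r₂ d + suc (suc i)              ≤⟨ +-monoʳ-≤ (level r₂ d) (s≤s i<h) ⟩
            level r₂ d + suc h
              ≡⟨ cong (λ t → level r₂ d + suc t) (≡.trans (cong (at w₂) (flip-flip lo<n)) (at-length lo)) ⟨
            level r₂ d + suc (at w₂ (n ∸ suc d))  ≡⟨ level-word X₂ (flip-< (length lo) lo<n) ⟩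
            n                                     ≡⟨ K+2+i≡n ⟨
            K + suc (suc i)                       ∎)
            where
            open ≤-Reasoning
            r₂ = fromRight (wordBoard X₂)

  -- For M zero or negative, M - 1 is below every natural number, so only positive M remains.
  exceeds : ∀ {i} M → + i <ᶻ M -ᶻ 1ℤ → ∃[ m ] M ≡ + m × suc (suc i) ≤ m
  exceeds (+ suc m) (ℤ.+<+ i<m) = suc m , refl , s≤s i<m

  successor-repeated : ∀ {n} (B : FerrersBoard n) → BelowDiagonal (columnHeights B) →
    ∀ M → multiplicity B M ≢ 0 → Connected B →
    ∀ i → + i <ᶻ M -ᶻ 1ℤ → multiplicity B (+ i) > 1 → multiplicity B (+ i +ᶻ 1ℤ) > 1
  successor-repeated {n} B below M M-root connected i i<M-1 i-twice
    with m , refl , i+2≤m ← exceeds M i<M-1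
    with c , c<n , refl ← multiplicity⇒occurs B below m M-root
    with 2 ≤? multiplicity B (+ i +ᶻ 1ℤ)
  ... | yes twice  = twice
  ... | no ¬twice = contradiction connected
    (Necessity.disconnected B below (n ∸ suc (suc i)) i (m∸n+n≡m i+2≤n)
      (λ r → ¬twice (subst (λ t → multiplicity B (+ t) > 1) (+-comm 1 i)
        (repeated⇒multiplicity B below (suc i) r)))
      (c , c<n , i+2≤m) (multiplicity⇒repeated B below i i-twice))
    where
    i+2≤n : suc (suc i) ≤ n
    i+2≤n = ≤-trans i+2≤m (≤-trans (m∸n≤m c (at (columnHeights B) c)) (<⇒≤ c<n))

open BoardsAsWords

open import Data.Integer.Base using (_+_; _-_; _≤_; _<_)
open import Data.Vec.Relation.Unary.All using (All)

theorem10 : ∀ (n : ℕ) (B : FerrersBoard n) →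
    All (0ℤ ≤_) (rootVector B) →
    ∀ (M : ℤ) → IsGreatestRoot B M →
    Connected B ⇔
    (∀ (i : ℤ) → 0ℤ ≤ i → i < M - 1ℤ →
    multiplicity B i > 1 → multiplicity B (i + 1ℤ) > 1)
theorem10 n B nonneg M (M-root , M-greatest) =
  mk⇔ necessary (Sufficiency.connected B below M M-greatest)
  where
  below = Multiplicities.below-diagonal B nonneg

  necessary : Connected B → ∀ i → 0ℤ ≤ i → i < M - 1ℤ →
    multiplicity B i > 1 → multiplicity B (i + 1ℤ) > 1
  necessary connected (+ i) _ = successor-repeated B below M M-root connected i
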